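{- Let $n,m,p$ be nonnegative integers, and put $$\alpha_j^{(n,m)}=\binom{n}{j}(n+m-j)!,\qquad \beta_j^{(n,m)}=(-1)^j\binom{m}{j}(n+m-j)!,\qquad \gamma_j^{(n,m)}=(-1)^m\frac{n!\,(m+j)!}{(m+n+1+j)!\,j!}.$$ Then the Apostol-type polynomials of consecutive orders $\alpha$ and $\alpha+1$ satisfy the following relations (for each family, for all $\lambda,\alpha$ for which the polynomials are defined, and all $x$). If $0\le p\le m+n$, then $$\sum_{j=0}^{\max(m,n)}\left(\lambda\alpha_j^{(n,m)}-\beta_j^{(n,m)}\right)\frac{\mathcal{B}_{p-j}^{(\alpha+1)}(x;\lambda)}{(p-j)!}=\sum_{j=0}^{m}\beta_j^{(n,m)}\frac{\mathcal{B}_{p-j-1}^{(\alpha)}(x;\lambda)}{(p-j-1)!},$$ $$\sum_{j=0}^{\max(m,n)}\left(\lambda\alpha_j^{(n,m)}+\beta_j^{(n,m)}\right)\frac{\mathcal{E}_{p-j}^{(\alpha+1)}(x;\lambda)}{(p-j)!}=2\sum_{j=0}^{m}\beta_j^{(n,m)}\frac{\mathcal{E}_{p-j}^{(\alpha)}(x;\lambda)}{(p-j)!},$$ $$\sum_{j=0}^{\max(m,n)}\left(\lambda\alpha_j^{(n,m)}+\beta_j^{(n,m)}\right)\frac{\mathcal{G}_{p-j}^{(\alpha+1)}(x;\lambda)}{(p-j)!}=2\sum_{j=0}^{m}\beta_j^{(n,m)}\frac{\mathcal{G}_{p-j-1}^{(\alpha)}(x;\lambda)}{(p-j-1)!}.$$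 If $p\ge m+n+1$, then $$\sum_{j=0}^{\max(m,n)}\left(\lambda\alpha_j^{(n,m)}-\beta_j^{(n,m)}\right)\frac{\mathcal{B}_{p-j}^{(\alpha+1)}(x;\lambda)}{(p-j)!}=\sum_{j=0}^{m}\beta_j^{(n,m)}\frac{\mathcal{B}_{p-j-1}^{(\alpha)}(x;\lambda)}{(p-j-1)!}-\lambda\sum_{j=0}^{p-m-n-1}\gamma_j^{(n,m)}\frac{\mathcal{B}_{p-m-n-j-1}^{(\alpha+1)}(x;\lambda)}{(p-m-n-j-1)!},$$ $$\sum_{j=0}^{\max(m,n)}\left(\lambda\alpha_j^{(n,m)}+\beta_j^{(n,m)}\right)\frac{\mathcal{E}_{p-j}^{(\alpha+1)}(x;\lambda)}{(p-j)!}=2\sum_{j=0}^{m}\beta_j^{(n,m)}\frac{\mathcal{E}_{p-j}^{(\alpha)}(x;\lambda)}{(p-j)!}-\lambda\sum_{j=0}^{p-m-n-1}\gamma_j^{(n,m)}\frac{\mathcal{E}_{p-m-n-j-1}^{(\alpha+1)}(x;\lambda)}{(p-m-n-j-1)!},$$ $$\sum_{j=0}^{\max(m,n)}\left(\lambda\alpha_j^{(n,m)}+\beta_j^{(n,m)}\right)\frac{\mathcal{G}_{p-j}^{(\alpha+1)}(x;\lambda)}{(p-j)!}=2\sum_{j=0}^{m}\beta_j^{(n,m)}\frac{\mathcal{G}_{p-j-1}^{(\alpha)}(x;\lambda)}{(p-j-1)!}-\lambda\sum_{j=0}^{p-m-n-1}\gamma_j^{(n,m)}\frac{\mathcal{G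}_{p-m-n-j-1}^{(\alpha+1)}(x;\lambda)}{(p-m-n-j-1)!}.$$
   Context: The symbols $\alpha_j^{(n,m)}$ are integer coefficients, not to be confused with the order $\alpha$; $\binom{a}{j}=0$ for integers $j>a\ge 0$, so $\alpha_j^{(n,m)}=0$ for $j>n$ and $\beta_j^{(n,m)}=0$ for $j>m$. The Apostol-Bernoulli, Apostol-Euler and Apostol-Genocchi polynomials of order $\alpha$ in the variable $x$ (real or complex) are defined by the generating functions (power series expansions in $t$ around $t=0$) $$\left(\frac{t}{\lambda e^t-1}\right)^{\alpha}e^{xt}=\sum_{k=0}^\infty \mathcal{B}_k^{(\alpha)}(x;\lambda)\frac{t^k}{k!},\qquad \left(\frac{2}{\lambda e^t+1}\right)^{\alpha}e^{xt}=\sum_{k=0}^\infty \mathcal{E}_k^{(\alpha)}(x;\lambda)\frac{t^k}{k!},\qquad \left(\frac{2t}{\lambda e^t+1}\right)^{\alpha}e^{xt}=\sum_{k=0}^\infty \mathcal{G}_k^{(\alpha)}(x;\lambda)\frac{t^k}{k!}.$$ Here $\lambda\in\mathbb{C}$, $1^\alpha:=1$, and the powers are taken with a fixed branch of the logarithm analytic near $t=0$ (the same branch for orders $\alpha$ and $\alpha+1$). The range of parameters is: for $\mathcal{B}$, $\alpha\in\mathbb{C}$ if $\lambda=1$, and $\alpha$ a nonnegative integer if $\lambda\neq 1$; for $\mathcal{E}$, $\alpha\in\mathbb{C}$ and $\lambda\ne -1$; for $\mathcal{G}$, $\alpha\in\mathbb{C}$ if $\lambda=-1$, and $\alpha$ a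 nonnegative integer if $\lambda\ne -1$. Convention: polynomials with negative index are zero, and any term containing such a polynomial (including the accompanying factorial of a negative integer in the denominator) is zero. -}

module Defs where

open import Level using (_⊔_) renaming (suc to lsuc)
open import Data.Nat.Base as ℕ using (ℕ; zero; suc; _∸_; _!)
open import Data.Nat.Combinatorics using (_C_)
open import Data.Nat.Properties using (m*n≢0; _!≢0)
open import Data.Integer.Base using (ℤ; +_; -[1+_])
open import Data.Fin.Base using (toℕ)
open import Data.Product.Base using (proj₁; _,_)
open import Algebra.Bundles using (CommutativeRing)
open import Algebra.Apartness.Bundles using (HeytingField)
open import Algebra.Morphism.Structures using (module MonoidMorphisms)
import Algebra.Apartness.Properties.HeytingCommutativeRing as HCRProperties
import Algebra.Definitions.RawMonoid as RawMonoidDefs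
import Algebra.Properties.Monoid.Sum as MonoidSum
import Algebra.Properties.Ring as RingProperties
import Algebra.Properties.Semiring.Exp as SemiringExp

-- A field of characteristic zero with an exponential map from its additive
-- to its multiplicative structure.  The intended instance is ℂ with the usual
-- exponential, where x # y is x ≠ y; a Heyting field makes division by an
-- element apart from zero available constructively.
record ExponentialField c ℓ₁ ℓ₂ : Set (lsuc (c ⊔ ℓ₁ ⊔ ℓ₂)) where
  field
    heytingField : HeytingField c ℓ₁ ℓ₂

  open HeytingField heytingField public

  commutativeRing : CommutativeRing c ℓ₁
  commutativeRing = record { isCommutativeRing = isCommutativeRing }

  open CommutativeRing commutativeRing public
    using (ring; semiring; +-monoid; +-rawMonoid; *-rawMonoid)

  open RawMonoidDefs +-rawMonoid public using (_×_)

  field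
    characteristicZero : ∀ n → suc n × 1# # 0#
    exp                : Carrier → Carrier
    exp-homomorphism   :
      MonoidMorphisms.IsMonoidHomomorphism +-rawMonoid *-rawMonoid exp


module Apostol {c ℓ₁ ℓ₂} (𝕂 : ExponentialField c ℓ₁ ℓ₂) where

  open ExponentialField 𝕂 public
    hiding (_×_; zero; refl; sym; trans; reflexive)
  open ExponentialField 𝕂 using (_×_; refl; sym; trans)
  open SemiringExp semiring public using (_^_)
  open MonoidSum +-monoid using (sum)
  open HCRProperties (HeytingField.heytingCommutativeRing heytingField)
    using (1#0; #-congʳ; x-0≈x; invertibleʳ⇒#)
  open RingProperties ring using (-‿involutive; -‿distribˡ-*)

  -- Unlike the library's ∑[ i ≤ n ], the index here is a natural number.
  sumUpTo : ℕ → (ℕ → Carrier) → Carrier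
  sumUpTo n f = sum {suc n} (λ i → f (toℕ i))

  infixl 8 sumUpTo
  syntax sumUpTo n (λ j → x) = ∑[ j ≤ n ] x

  ι : ℕ → Carrier
  ι n = n × 1#

  recip : ∀ {x} → x # 0# → Carrier
  recip x#0 = proj₁ (#⇒invertible x#0)

  ι#0 : ∀ n → .{{ℕ.NonZero n}} → ι n # 0#
  ι#0 (suc n) = characteristicZero n

  1/ι : ∀ n → .{{ℕ.NonZero n}} → Carrier
  1/ι n = recip (ι#0 n)

  1/_! : ℕ → Carrier
  1/ k ! = 1/ι (k !) {{k !≢0}}

  -- P k / k! at an integer index, zero when the index is negative.
  infix 8 _/!_
  _/!_ : (ℕ → Carrier) → ℤ → Carrier
  P /! (+ k)    = P k * 1/ k !
  P /! -[1+ _ ] = 0#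


  -- Formal power series in t over the field: n ↦ the coefficient of tⁿ.

  Series : Set c
  Series = ℕ → Carrier

  const : Carrier → Series
  const a zero    = a
  const a (suc _) = 0#

  infixl 6 _⊕_
  infixl 7 _⊛_ _•_
  infixr 8 _^ₛ_

  _⊕_ _⊛_ : Series → Series → Series
  (f ⊕ g) n = f n + g n
  (f ⊛ g) n = ∑[ i ≤ n ] (f i * g (n ∸ i))

  _•_ : Carrier → Series → Series
  (a • f) n = a * f n

  _^ₛ_ : Series → ℕ → Series
  f ^ₛ zero  = const 1#
  f ^ₛ suc k = f ⊛ f ^ₛ k

  t·_ : Series → Series
  (t· f) zero    = 0#
  (t· f) (suc n) = f n

  -- f / t, for f without constant term.
  _/t : Series → Series
  (f /t) n = f (suc n)

  dropConst : Series → Series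
  dropConst f zero    = 0#
  dropConst f (suc n) = f (suc n)

  -- The composite a(f − f(0)).  The k-th power of a series without constant
  -- term starts at tᵏ, so the terms with k > n do not contribute to tⁿ.
  _∘₀_ : Series → Series → Series
  (a ∘₀ f) n = ∑[ k ≤ n ] (a k * (dropConst f ^ₛ k) n)

  -- 1/f = c⁻¹ ∑ₖ (1 − f/c)ᵏ, where c = f(0).
  inverse : (f : Series) → f 0 # 0# → Series
  inverse f f₀#0 = c⁻¹ • ((λ _ → 1#) ∘₀ ((- c⁻¹) • f))
    where c⁻¹ = recip f₀#0

  -- e^{xt}
  exp-t : Carrier → Series
  exp-t x k = x ^ k * 1/ k !

  -- log(1 + t)
  log[1+t] : Series
  log[1+t] zero    = 0#
  log[1+t] (suc k) = (- 1#) ^ k * 1/ι (suc k)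

  expₛ : Series → Series
  expₛ f = exp (f 0) • (exp-t 1# ∘₀ f)

  -- A value of the logarithm at a, normalised so that 1^α = exp (α log 1) = 1.
  -- A branch of log f(t) analytic near t = 0 is determined by its value at 0.
  record Logarithm (a : Carrier) : Set (c ⊔ ℓ₁) where
    field
      value      : Carrier
      exp-value  : exp value ≈ a
      normalised : a ≈ 1# → value ≈ 0#

  -- log f = L + log(f/c), where c = f(0) and exp L = c; exp (- L) is 1/c.
  logₛ : (f : Series) → Logarithm (f 0) → Series
  logₛ f L = const value ⊕ (log[1+t] ∘₀ (exp (- value) • f))
    where open Logarithm L

  pow : (f : Series) → Logarithm (f 0) → Carrier → Series
  pow f L α = expₛ (α • logₛ f L)


  1/0!≈1 : 1/ 0 ! ≈ 1#
  1/0!≈1 with #⇒invertible (ι#0 1)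
  ... | (y , y*[1-0]≈1 , _) =
    trans (sym (*-identityʳ y))
      (trans (*-congˡ (sym (trans (x-0≈x _) (+-identityʳ 1#)))) y*[1-0]≈1)

  x*exp₀≈x : ∀ x → x * exp-t 1# 0 ≈ x
  x*exp₀≈x x =
    trans (*-congˡ (trans (*-identityˡ _) 1/0!≈1)) (*-identityʳ x)

  x*exp₁≈x : ∀ x → x * exp-t 1# 1 ≈ x
  x*exp₁≈x x =
    trans (*-congˡ (trans (*-congʳ (*-identityʳ 1#))
                          (trans (*-identityˡ _) 1/0!≈1)))
          (*-identityʳ x)

  #⇒-#0 : ∀ {x y} → x # y → x - y # 0#
  #⇒-#0 {x} {y} x#y with #⇒invertible x#y
  ... | (z , _ , [x-y]*z≈1) =
    invertibleʳ⇒# (z , trans (*-congʳ (x-0≈x (x - y))) [x-y]*z≈1)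

  -1#0 : - 1# # 0#
  -1#0 = invertibleʳ⇒# (- 1# ,
    trans (*-congʳ (x-0≈x (- 1#)))
      (trans (sym (-‿distribˡ-* 1# (- 1#)))
        (trans (-‿cong (*-identityˡ (- 1#))) (-‿involutive 1#))))


  module _ (λ′ : Carrier) where

    λeᵗ-1 λeᵗ+1 : Series
    λeᵗ-1 = (λ′ • exp-t 1#) ⊕ const (- 1#)
    λeᵗ+1 = (λ′ • exp-t 1#) ⊕ const 1#

    λeᵗ-1#0 : λ′ # 1# → λeᵗ-1 0 # 0#
    λeᵗ-1#0 λ#1 = #-congʳ (+-congʳ (sym (x*exp₀≈x λ′))) (#⇒-#0 λ#1)

    [λeᵗ-1]/t#0 : λ′ ≈ 1# → (λeᵗ-1 /t) 0 # 0#
    [λeᵗ-1]/t#0 λ≈1 =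
      #-congʳ (sym (trans (+-identityʳ _) (trans (x*exp₁≈x λ′) λ≈1))) 1#0

    λeᵗ+1#0 : λ′ # - 1# → λeᵗ+1 0 # 0#
    λeᵗ+1#0 λ#-1 =
      #-congʳ (+-cong (sym (x*exp₀≈x λ′)) (-‿involutive 1#)) (#⇒-#0 λ#-1)

    [λeᵗ+1]/t#0 : λ′ ≈ - 1# → (λeᵗ+1 /t) 0 # 0#
    [λeᵗ+1]/t#0 λ≈-1 =
      #-congʳ (sym (trans (+-identityʳ _) (trans (x*exp₁≈x λ′) λ≈-1))) -1#0

    -- t/(λeᵗ−1) for λ = 1 and for λ ≠ 1.  In the first case numerator and
    -- denominator are both divided by t, and the value at 0 is nonzero.
    baseℬ≡ : λ′ ≈ 1# → Series
    baseℬ≡ λ≈1 = inverse (λeᵗ-1 /t) ([λeᵗ-1]/t#0 λ≈1)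

    baseℬ≠ : λ′ # 1# → Series
    baseℬ≠ λ#1 = t· inverse λeᵗ-1 (λeᵗ-1#0 λ#1)

    baseℰ : λ′ # - 1# → Series
    baseℰ λ#-1 = ι 2 • inverse λeᵗ+1 (λeᵗ+1#0 λ#-1)

    -- 2t/(λeᵗ+1) for λ = −1 and for λ ≠ −1.
    base𝒢≡ : λ′ ≈ - 1# → Series
    base𝒢≡ λ≈-1 = ι 2 • inverse (λeᵗ+1 /t) ([λeᵗ+1]/t#0 λ≈-1)

    base𝒢≠ : λ′ # - 1# → Series
    base𝒢≠ λ#-1 = t· (ι 2 • inverse λeᵗ+1 (λeᵗ+1#0 λ#-1))

    -- The admissible orders α for a given λ, with the branch of the logarithm
    -- when α is a field element.

    data Orderℬ : Set (c ⊔ ℓ₁ ⊔ ℓ₂) where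
      complex : (λ≈1 : λ′ ≈ 1#) (L : Logarithm (baseℬ≡ λ≈1 0))
                (α : Carrier) → Orderℬ
      natural : (λ#1 : λ′ # 1#) (α : ℕ) → Orderℬ

    data Orderℰ : Set (c ⊔ ℓ₁ ⊔ ℓ₂) where
      complex : (λ#-1 : λ′ # - 1#) (L : Logarithm (baseℰ λ#-1 0))
                (α : Carrier) → Orderℰ

    data Order𝒢 : Set (c ⊔ ℓ₁ ⊔ ℓ₂) where
      complex : (λ≈-1 : λ′ ≈ - 1#) (L : Logarithm (base𝒢≡ λ≈-1 0))
                (α : Carrier) → Order𝒢
      natural : (λ#-1 : λ′ # - 1#) (α : ℕ) → Order𝒢

  module _ {λ′ : Carrier} where

    -- α ↦ α + 1 with the same branch.

    sucℬ : Orderℬ λ′ → Orderℬ λ′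
    sucℬ (complex λ≈1 L α) = complex λ≈1 L (α + 1#)
    sucℬ (natural λ#1 α)   = natural λ#1 (suc α)

    sucℰ : Orderℰ λ′ → Orderℰ λ′
    sucℰ (complex λ#-1 L α) = complex λ#-1 L (α + 1#)

    suc𝒢 : Order𝒢 λ′ → Order𝒢 λ′
    suc𝒢 (complex λ≈-1 L α) = complex λ≈-1 L (α + 1#)
    suc𝒢 (natural λ#-1 α)   = natural λ#-1 (suc α)

    powerℬ : Orderℬ λ′ → Series
    powerℬ (complex λ≈1 L α) = pow (baseℬ≡ λ′ λ≈1) L α
    powerℬ (natural λ#1 α)   = baseℬ≠ λ′ λ#1 ^ₛ α

    powerℰ : Orderℰ λ′ → Series
    powerℰ (complex λ#-1 L α) = pow (baseℰ λ′ λ#-1) L α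

    power𝒢 : Order𝒢 λ′ → Series
    power𝒢 (complex λ≈-1 L α) = pow (base𝒢≡ λ′ λ≈-1) L α
    power𝒢 (natural λ#-1 α)   = base𝒢≠ λ′ λ#-1 ^ₛ α

    -- The values at x of the polynomials, of order α and of degree index k.

    ℬ : Orderℬ λ′ → Carrier → ℕ → Carrier
    ℬ α x k = ι (k !) * (powerℬ α ⊛ exp-t x) k

    ℰ : Orderℰ λ′ → Carrier → ℕ → Carrier
    ℰ α x k = ι (k !) * (powerℰ α ⊛ exp-t x) k

    𝒢 : Order𝒢 λ′ → Carrier → ℕ → Carrier
    𝒢 α x k = ι (k !) * (power𝒢 α ⊛ exp-t x) k


  coeffα coeffβ coeffγ : (n m j : ℕ) → Carrier
  coeffα n m j = ι ((n C j) ℕ.* (n ℕ.+ m ∸ j) !)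
  coeffβ n m j = (- 1#) ^ j * ι ((m C j) ℕ.* (n ℕ.+ m ∸ j) !)
  coeffγ n m j = (- 1#) ^ m * (ι (n ! ℕ.* (m ℕ.+ j) !)
    * 1/ι ((m ℕ.+ n ℕ.+ 1 ℕ.+ j) ! ℕ.* j !)
        {{m*n≢0 _ _ {{(m ℕ.+ n ℕ.+ 1 ℕ.+ j) !≢0}} {{j !≢0}}}})

{-# OPTIONS --safe #-}
module Submission where

-- Let e = eᵗ and write α, β, γ for the polynomials in t with coefficients
-- α_j, β_j and the power series with coefficients γ_j.  The quotient α/β is
-- the Padé approximant of eᵗ of type (n, m), in the explicit form
--
--   β e = α + t^(m+n+1) γ                                       (padé).
--
-- It is proved by induction on m.  Each of the three terms X(n,m) satisfies
-- X(n,m+1) + t X(n,m) = X(n+1,m): for α and β this is Pascal's rule, for γ a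
-- computation with factorials (coeffα-rec, coeffβ-rec, coeffγ-rec).  For m = 0
-- the identity splits n! eᵗ after the term of degree n.
--
-- Multiplying by λ and adding s β, where s = -1 for the family ℬ and s = 1 for
-- ℰ and 𝒢, gives
--
--   (λ α + s β) + λ t^(m+n+1) γ = β (λ e + s).
--
-- Multiply this by the generating function F of the higher order.  Since
-- (λ e + s) F is t, 2 or 2t times the generating function of the lower order
-- (ℬ-equation, ℰ-equation, 𝒢-equation), comparing the coefficients of tᵖ gives
-- the claimed relations (padé-relation); the term with γ contributes nothing for
-- p ≤ m + n.
--
-- Now let α be the order.  Passing from α to α + 1 multiplies the power by its
-- base f.  This is the definition when the order is a natural number.  For other
-- orders the power is exp (α log f), and
--
--   f · exp (α log f) = exp ((α + 1) log f)
--
-- holds because both sides solve the equation θ y = (α + 1) θ(log f) · y, where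
-- θ = t d/dt, with the same constant term (pow-suc, θ-unique).  This needs the
-- chain rule for composites of power series, which follows from Horner's rule
-- a(u) = a₀ + u · (a/t)(u) by induction on the coefficient (horner, chain-rule).

open import Defs
open import Data.Nat.Base as ℕ using (ℕ; zero; suc; _≤_; _<_; _≥_; _⊔_; _∸_; _!; z≤n; s≤s)
import Data.Nat.Properties as ℕₚ
open import Data.Nat.Combinatorics
  using (_C_; k>n⇒nCk≡0; nCk≡n!/k![n-k]!; k![n∸k]!∣n!; nCk+nC[k+1]≡[n+1]C[k+1])
open import Data.Nat.DivMod using (m/n*n≡m)
open import Data.Nat.Solver using (module +-*-Solver)
open import Data.Integer.Base using (ℤ; +_; -[1+_]; _⊖_)
import Data.Integer.Properties as ℤₚ
open import Data.Product.Base using (_×_; _,_; proj₂)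
open import Data.Empty using (⊥-elim)
open import Data.Sum.Base using (inj₁; inj₂)
open import Relation.Binary.PropositionalEquality.Core as ≡ using (_≡_)
open import Relation.Binary.Bundles using (Setoid)
open import Algebra.Bundles using (CommutativeRing; CommutativeSemiring)
open import Algebra.Structures.Biased using (isCommutativeSemiringˡ)
open import Algebra.Morphism.Structures using (module MonoidMorphisms)
import Algebra.Properties.Group as GroupProperties
import Algebra.Properties.Ring as RingProperties
import Algebra.Properties.Semiring.Mult as SemiringMult
import Algebra.Apartness.Properties.HeytingCommutativeRing as HCRProperties
import Algebra.Solver.Ring.NaturalCoefficients.Default as SemiringSolver
import Relation.Binary.Reasoning.Setoid as SetoidReasoning

module FormalSeries {c ℓ₁ ℓ₂} (𝕂 : ExponentialField c ℓ₁ ℓ₂) where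

  open Apostol 𝕂
  open CommutativeRing commutativeRing
    using (refl; sym; trans; reflexive; +-group; commutativeSemiring)
    renaming (setoid to ≈-setoid)
  open GroupProperties +-group using (//-rightDividesʳ) renaming (∙-cancelʳ to +-cancelʳ)
  open RingProperties ring using (-1*x≈-x)
  open SemiringMult semiring using (×-homo-+; ×1-homo-*)
  open HCRProperties heytingCommutativeRing using (x-0≈x)
  open SemiringSolver commutativeSemiring using (solve; _:=_; _:+_; _:*_; con)
  open SetoidReasoning ≈-setoid
  open MonoidMorphisms.IsMonoidHomomorphism exp-homomorphism using ()
    renaming (homo to exp-+; ε-homo to exp-0; ⟦⟧-cong to exp-cong)

  -- Fractions of natural numbers in the field

  ι-+ : ∀ m n → ι (m ℕ.+ n) ≈ ι m + ι n
  ι-+ = ×-homo-+ 1#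

  ι-* : ∀ m n → ι (m ℕ.* n) ≈ ι m * ι n
  ι-* = ×1-homo-*

  ι1≈1 : ι 1 ≈ 1#
  ι1≈1 = +-identityʳ 1#

  ι-cong : ∀ {m n} → m ≡ n → ι m ≈ ι n
  ι-cong m≡n = reflexive (≡.cong ι m≡n)

  *-recip : ∀ {x} (x#0 : x # 0#) → x * recip x#0 ≈ 1#
  *-recip {x} x#0 =
    trans (*-congʳ (sym (x-0≈x x))) (proj₂ (proj₂ (#⇒invertible x#0)))

  ι*1/ι≈1 : ∀ n .{{_ : ℕ.NonZero n}} → ι n * 1/ι n ≈ 1#
  ι*1/ι≈1 n = *-recip (ι#0 n)

  fraction-cong : ∀ {a b c d} .{{_ : ℕ.NonZero b}} .{{_ : ℕ.NonZero d}} →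
    a ℕ.* d ≡ c ℕ.* b → ι a * 1/ι b ≈ ι c * 1/ι d
  fraction-cong {a} {b} {c} {d} ad≡cb = begin
    ι a * 1/ι b                      ≈⟨ *-identityʳ _ ⟨
    ι a * 1/ι b * 1#                 ≈⟨ *-congˡ (ι*1/ι≈1 d) ⟨
    ι a * 1/ι b * (ι d * 1/ι d)      ≈⟨ shuffle (ι a) _ (ι d) _ ⟩
    ι a * ι d * (1/ι b * 1/ι d)      ≈⟨ *-congʳ cross ⟩
    ι c * ι b * (1/ι b * 1/ι d)      ≈⟨ *-congˡ (*-comm _ _) ⟩
    ι c * ι b * (1/ι d * 1/ι b)      ≈⟨ shuffle (ι c) _ _ _ ⟨
    ι c * 1/ι d * (ι b * 1/ι b)      ≈⟨ *-congˡ (ι*1/ι≈1 b) ⟩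
    ι c * 1/ι d * 1#                 ≈⟨ *-identityʳ _ ⟩
    ι c * 1/ι d                      ∎
    where
    shuffle : ∀ w x y z → w * x * (y * z) ≈ w * y * (x * z)
    shuffle = solve 4 (λ w x y z → w :* x :* (y :* z) := w :* y :* (x :* z)) refl

    cross : ι a * ι d ≈ ι c * ι b
    cross = trans (sym (ι-* a d)) (trans (ι-cong ad≡cb) (ι-* c b))

  integer-fraction : ∀ {a c d} .{{_ : ℕ.NonZero d}} →
    a ℕ.* d ≡ c → ι a ≈ ι c * 1/ι d
  integer-fraction {a} {c} {d} ad≡c = begin
    ι a                   ≈⟨ *-identityʳ _ ⟨
    ι a * 1#              ≈⟨ *-congˡ (ι*1/ι≈1 d) ⟨
    ι a * (ι d * 1/ι d)   ≈⟨ *-assoc _ _ _ ⟨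
    ι a * ι d * 1/ι d     ≈⟨ *-congʳ (ι-* a d) ⟨
    ι (a ℕ.* d) * 1/ι d   ≈⟨ *-congʳ (ι-cong ad≡c) ⟩
    ι c * 1/ι d           ∎

  ι-cancelˡ : ∀ n .{{_ : ℕ.NonZero n}} {x y} → ι n * x ≈ ι n * y → x ≈ y
  ι-cancelˡ n {x} {y} nx≈ny = begin
    x                   ≈⟨ lemma x ⟨
    1/ι n * (ι n * x)   ≈⟨ *-congˡ nx≈ny ⟩
    1/ι n * (ι n * y)   ≈⟨ lemma y ⟩
    y                   ∎
    where
    lemma : ∀ z → 1/ι n * (ι n * z) ≈ z
    lemma z = trans (sym (*-assoc _ _ _))
      (trans (*-congʳ (trans (*-comm _ _) (ι*1/ι≈1 n))) (*-identityˡ z))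

  -- The semiring of formal power series

  -- Coefficientwise equality, as a record so that the two series can be
  -- inferred from a proof.
  infix 4 _≋_
  record _≋_ (f g : Series) : Set ℓ₁ where
    constructor pointwise
    field coeff : ∀ n → f n ≈ g n
  open _≋_

  ≋-setoid : Setoid c ℓ₁
  ≋-setoid = record
    { Carrier       = Series
    ; _≈_           = _≋_
    ; isEquivalence = record
      { refl  = pointwise λ _ → refl
      ; sym   = λ p → pointwise λ n → sym (coeff p n)
      ; trans = λ p q → pointwise λ n → trans (coeff p n) (coeff q n)
      }
    }

  open Setoid ≋-setoid using ()
    renaming (refl to ≋-refl; sym to ≋-sym; trans to ≋-trans)

  -- The coefficient of tⁿ in a product only sees the coefficients up to tⁿ.
  ⊛-cong-≤ : ∀ {f f′ g g′} n →
    (∀ i → i ≤ n → f i ≈ f′ i) → (∀ i → i ≤ n → g i ≈ g′ i) →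
    (f ⊛ g) n ≈ (f′ ⊛ g′) n
  ⊛-cong-≤ zero    p q = +-congʳ (*-cong (p 0 z≤n) (q 0 z≤n))
  ⊛-cong-≤ (suc n) p q =
    +-cong (*-cong (p 0 z≤n) (q (suc n) ℕₚ.≤-refl))
      (⊛-cong-≤ n (λ i i≤n → p (suc i) (s≤s i≤n))
                  (λ i i≤n → q i (ℕₚ.m≤n⇒m≤1+n i≤n)))

  ⊛-cong : ∀ {f f′ g g′} → f ≋ f′ → g ≋ g′ → f ⊛ g ≋ f′ ⊛ g′
  ⊛-cong p q = pointwise λ n → ⊛-cong-≤ n (λ i _ → coeff p i) (λ i _ → coeff q i)

  ⊛-congˡ : ∀ f {g g′} → g ≋ g′ → f ⊛ g ≋ f ⊛ g′
  ⊛-congˡ f = ⊛-cong (≋-refl {f})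

  ⊛-congʳ : ∀ g {f f′} → f ≋ f′ → f ⊛ g ≋ f′ ⊛ g
  ⊛-congʳ g p = ⊛-cong p (≋-refl {g})

  ⊕-cong : ∀ {f f′ g g′} → f ≋ f′ → g ≋ g′ → f ⊕ g ≋ f′ ⊕ g′
  ⊕-cong p q = pointwise λ n → +-cong (coeff p n) (coeff q n)

  ⊕-congˡ : ∀ f {g g′} → g ≋ g′ → f ⊕ g ≋ f ⊕ g′
  ⊕-congˡ f = ⊕-cong (≋-refl {f})

  ⊕-congʳ : ∀ g {f f′} → f ≋ f′ → f ⊕ g ≋ f′ ⊕ g
  ⊕-congʳ g p = ⊕-cong p (≋-refl {g})

  •-cong : ∀ {a b f g} → a ≈ b → f ≋ g → a • f ≋ b • g
  •-cong p q = pointwise λ n → *-cong p (coeff q n)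

  t·-cong : ∀ {f g} → f ≋ g → t· f ≋ t· g
  t·-cong p = pointwise λ where
    zero    → refl
    (suc n) → coeff p n

  ⊛-zeroˡ-coeff : ∀ {f} g n → (∀ i → i ≤ n → f i ≈ 0#) → (f ⊛ g) n ≈ 0#
  ⊛-zeroˡ-coeff g zero    p =
    trans (+-identityʳ _) (trans (*-congʳ (p 0 z≤n)) (zeroˡ _))
  ⊛-zeroˡ-coeff g (suc n) p =
    trans (+-cong (trans (*-congʳ (p 0 z≤n)) (zeroˡ _))
                  (⊛-zeroˡ-coeff g n (λ i i≤n → p (suc i) (s≤s i≤n))))
          (+-identityˡ 0#)

  -- The mirror image of (f ⊛ g) (suc n) = f 0 * g (suc n) + ((f /t) ⊛ g) n, which
  -- holds by definition.
  ⊛-coeff-suc′ : ∀ f g n →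
    (f ⊛ g) (suc n) ≈ f (suc n) * g 0 + (f ⊛ (g /t)) n
  ⊛-coeff-suc′ f g zero    =
    solve 4 (λ a b c d → a :* d :+ (b :* c :+ con 0) := b :* c :+ (a :* d :+ con 0))
      refl (f 0) (f 1) (g 0) (g 1)
  ⊛-coeff-suc′ f g (suc n) = begin
    f 0 * g (suc (suc n)) + ((f /t) ⊛ g) (suc n)
      ≈⟨ +-congˡ (⊛-coeff-suc′ (f /t) g n) ⟩
    f 0 * g (suc (suc n)) + (f (suc (suc n)) * g 0 + ((f /t) ⊛ (g /t)) n)
      ≈⟨ solve 3 (λ a b c → a :+ (b :+ c) := b :+ (a :+ c)) refl _ _ _ ⟩
    f (suc (suc n)) * g 0 + (f 0 * g (suc (suc n)) + ((f /t) ⊛ (g /t)) n)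
      ∎

  ⊛-comm-coeff : ∀ n f g → (f ⊛ g) n ≈ (g ⊛ f) n
  ⊛-comm-coeff zero    f g = +-congʳ (*-comm (f 0) (g 0))
  ⊛-comm-coeff (suc n) f g = begin
    f 0 * g (suc n) + ((f /t) ⊛ g) n   ≈⟨ +-cong (*-comm _ _) (⊛-comm-coeff n (f /t) g) ⟩
    g (suc n) * f 0 + (g ⊛ (f /t)) n   ≈⟨ ⊛-coeff-suc′ g f n ⟨
    (g ⊛ f) (suc n)                    ∎

  ⊛-distribʳ-coeff : ∀ n h f g → ((f ⊕ g) ⊛ h) n ≈ (f ⊛ h) n + (g ⊛ h) n
  ⊛-distribʳ-coeff zero    h f g =
    solve 3 (λ h f g → (f :+ g) :* h :+ con 0 := f :* h :+ con 0 :+ (g :* h :+ con 0))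
      refl (h 0) (f 0) (g 0)
  ⊛-distribʳ-coeff (suc n) h f g =
    trans (+-congˡ (⊛-distribʳ-coeff n h (f /t) (g /t)))
      (solve 5 (λ h f g x y → (f :+ g) :* h :+ (x :+ y) := f :* h :+ x :+ (g :* h :+ y))
        refl (h (suc n)) (f 0) (g 0) (((f /t) ⊛ h) n) (((g /t) ⊛ h) n))

  •-⊛-coeff : ∀ n a f g → ((a • f) ⊛ g) n ≈ a * (f ⊛ g) n
  •-⊛-coeff zero    a f g =
    solve 3 (λ a x y → a :* x :* y :+ con 0 := a :* (x :* y :+ con 0)) refl a (f 0) (g 0)
  •-⊛-coeff (suc n) a f g =
    trans (+-congˡ (•-⊛-coeff n a (f /t) g))
      (solve 4 (λ a x y z → a :* x :* y :+ a :* z := a :* (x :* y :+ z))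
        refl a (f 0) (g (suc n)) (((f /t) ⊛ g) n))

  ⊛-assoc-coeff : ∀ n f g h → ((f ⊛ g) ⊛ h) n ≈ (f ⊛ (g ⊛ h)) n
  ⊛-assoc-coeff zero    f g h =
    solve 3 (λ x y z → (x :* y :+ con 0) :* z :+ con 0 := x :* (y :* z :+ con 0) :+ con 0)
      refl (f 0) (g 0) (h 0)
  ⊛-assoc-coeff (suc n) f g h = begin
    (f 0 * g 0 + 0#) * h (suc n) + (((f 0 • (g /t)) ⊕ ((f /t) ⊛ g)) ⊛ h) n
      ≈⟨ +-congˡ (⊛-distribʳ-coeff n h (f 0 • (g /t)) ((f /t) ⊛ g)) ⟩
    (f 0 * g 0 + 0#) * h (suc n) + (((f 0 • (g /t)) ⊛ h) n + (((f /t) ⊛ g) ⊛ h) n)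
      ≈⟨ +-congˡ (+-cong (•-⊛-coeff n (f 0) (g /t) h) (⊛-assoc-coeff n (f /t) g h)) ⟩
    (f 0 * g 0 + 0#) * h (suc n) + (f 0 * ((g /t) ⊛ h) n + ((f /t) ⊛ (g ⊛ h)) n)
      ≈⟨ solve 5 (λ x y z u v → (x :* y :+ con 0) :* z :+ (x :* u :+ v) := x :* (y :* z :+ u) :+ v)
           refl (f 0) (g 0) (h (suc n)) (((g /t) ⊛ h) n) (((f /t) ⊛ (g ⊛ h)) n) ⟩
    f 0 * (g 0 * h (suc n) + ((g /t) ⊛ h) n) + ((f /t) ⊛ (g ⊛ h)) n
      ∎

  const-⊛ : ∀ a f → const a ⊛ f ≋ a • f
  const-⊛ a f = pointwise λ where
    zero    → +-identityʳ _
    (suc n) → trans (+-congˡ (⊛-zeroˡ-coeff f n (λ _ _ → refl))) (+-identityʳ _)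

  seriesSemiring : CommutativeSemiring c ℓ₁
  seriesSemiring = record
    { Carrier = Series
    ; _≈_     = _≋_
    ; _+_     = _⊕_
    ; _*_     = _⊛_
    ; 0#      = const 0#
    ; 1#      = const 1#
    ; isCommutativeSemiring = isCommutativeSemiringˡ record
      { +-isCommutativeMonoid = record
        { isMonoid = record
          { isSemigroup = record
            { isMagma = record
              { isEquivalence = Setoid.isEquivalence ≋-setoid
              ; ∙-cong        = ⊕-cong
              }
            ; assoc = λ f g h → pointwise λ n → +-assoc (f n) (g n) (h n)
            }
          ; identity =
              (λ f → pointwise λ { zero → +-identityˡ _ ; (suc _) → +-identityˡ _ })
            , (λ f → pointwise λ { zero → +-identityʳ _ ; (suc _) → +-identityʳ _ })
          }
        ; comm = λ f g → pointwise λ n → +-comm (f n) (g n)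
        }
      ; *-isCommutativeMonoid = record
        { isMonoid = record
          { isSemigroup = record
            { isMagma = record
              { isEquivalence = Setoid.isEquivalence ≋-setoid
              ; ∙-cong        = ⊛-cong
              }
            ; assoc = λ f g h → pointwise λ n → ⊛-assoc-coeff n f g h
            }
          ; identity = ⊛-identityˡ
            , λ f → ≋-trans (pointwise λ n → ⊛-comm-coeff n f (const 1#)) (⊛-identityˡ f)
          }
        ; comm = λ f g → pointwise λ n → ⊛-comm-coeff n f g
        }
      ; distribʳ = λ h f g → pointwise λ n → ⊛-distribʳ-coeff n h f g
      ; zeroˡ    = λ f → ≋-trans (const-⊛ 0# f)
          (pointwise λ { zero → zeroˡ _ ; (suc _) → zeroˡ _ })
      }
    }
    where
    ⊛-identityˡ : ∀ f → const 1# ⊛ f ≋ f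
    ⊛-identityˡ f = ≋-trans (const-⊛ 1# f) (pointwise λ n → *-identityˡ (f n))

  open CommutativeSemiring seriesSemiring using () renaming
    ( +-identityˡ to ⊕-identityˡ; +-identityʳ to ⊕-identityʳ
    ; *-identityˡ to ⊛-identityˡ; *-identityʳ to ⊛-identityʳ; *-comm to ⊛-comm; *-assoc to ⊛-assoc
    ; distribˡ to ⊛-distribˡ; distribʳ to ⊛-distribʳ; zeroʳ to ⊛-zeroʳ
    )
  open SemiringSolver seriesSemiring using () renaming
    ( solve to ≋-solve; _:+_ to infixl 6 _⊞_; _:*_ to infixl 7 _⊠_; _:=_ to infix 4 _⊜_ )

  infixr 2 _≋⟨_⟩_ _≋⟨_⟨_
  infix  3 _□

  _≋⟨_⟩_ : ∀ f {g h} → f ≋ g → g ≋ h → f ≋ h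
  f ≋⟨ p ⟩ q = ≋-trans p q

  _≋⟨_⟨_ : ∀ f {g h} → g ≋ f → g ≋ h → f ≋ h
  f ≋⟨ p ⟨ q = ≋-trans (≋-sym p) q

  _□ : ∀ f → f ≋ f
  f □ = ≋-refl

  t·-⊛ : ∀ f g → t· f ⊛ g ≋ t· (f ⊛ g)
  t·-⊛ f g = pointwise λ where
    zero    → trans (+-identityʳ _) (zeroˡ _)
    (suc n) → trans (+-congʳ (zeroˡ _)) (+-identityˡ _)

  ⊛-t· : ∀ f g → f ⊛ t· g ≋ t· (f ⊛ g)
  ⊛-t· f g = ≋-trans (⊛-comm f (t· g)) (≋-trans (t·-⊛ g f) (t·-cong (⊛-comm g f)))

  •-⊛ : ∀ a f g → (a • f) ⊛ g ≋ a • (f ⊛ g)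
  •-⊛ a f g = pointwise λ n → •-⊛-coeff n a f g

  ⊛-• : ∀ a f g → f ⊛ (a • g) ≋ a • (f ⊛ g)
  ⊛-• a f g = ≋-trans (⊛-comm f (a • g)) (≋-trans (•-⊛ a g f) (•-cong refl (⊛-comm g f)))

  ⊕-cancelʳ : ∀ {f g h} → f ⊕ h ≋ g ⊕ h → f ≋ g
  ⊕-cancelʳ {f} {g} {h} p = pointwise λ n → +-cancelʳ (h n) (f n) (g n) (coeff p n)

  -- If u has no constant term, the coefficient of tⁿ in u ⊛ g only sees the
  -- coefficients of g below tⁿ.
  ⊛-cong-< : ∀ u {g h} n → u 0 ≈ 0# → (∀ i → i < n → g i ≈ h i) →
    (u ⊛ g) n ≈ (u ⊛ h) n
  ⊛-cong-< u zero    u₀≈0 p = +-congʳ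
    (trans (trans (*-congʳ u₀≈0) (zeroˡ _)) (sym (trans (*-congʳ u₀≈0) (zeroˡ _))))
  ⊛-cong-< u (suc n) u₀≈0 p = +-cong
    (trans (trans (*-congʳ u₀≈0) (zeroˡ _)) (sym (trans (*-congʳ u₀≈0) (zeroˡ _))))
    (⊛-cong-≤ {f = u /t} n (λ _ _ → refl) (λ i i≤n → p i (s≤s i≤n)))

  -- Finite sums

  ∑-cong : ∀ n (f g : ℕ → Carrier) → (∀ k → f k ≈ g k) →
    ∑[ k ≤ n ] (f k) ≈ ∑[ k ≤ n ] (g k)
  ∑-cong zero    f g p = +-congʳ (p 0)
  ∑-cong (suc n) f g p =
    +-cong (p 0) (∑-cong n (λ k → f (suc k)) (λ k → g (suc k)) (λ k → p (suc k)))

  ∑-zero : ∀ n (f : ℕ → Carrier) → (∀ k → k ≤ n → f k ≈ 0#) → ∑[ k ≤ n ] (f k) ≈ 0#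
  ∑-zero zero    f p = trans (+-identityʳ _) (p 0 z≤n)
  ∑-zero (suc n) f p =
    trans (+-cong (p 0 z≤n) (∑-zero n (λ k → f (suc k)) (λ k k≤n → p (suc k) (s≤s k≤n)))) (+-identityˡ 0#)

  ∑-+ : ∀ n (f g : ℕ → Carrier) →
    ∑[ k ≤ n ] (f k + g k) ≈ ∑[ k ≤ n ] (f k) + ∑[ k ≤ n ] (g k)
  ∑-+ zero    f g = solve 2 (λ x y → x :+ y :+ con 0 := x :+ con 0 :+ (y :+ con 0)) refl _ _
  ∑-+ (suc n) f g = trans (+-congˡ (∑-+ n (λ k → f (suc k)) (λ k → g (suc k))))
    (solve 4 (λ x y z w → x :+ y :+ (z :+ w) := x :+ z :+ (y :+ w)) refl _ _ _ _)

  ∑-truncate : ∀ {n N} (f : ℕ → Carrier) → n ≤ N → (∀ k → n < k → k ≤ N → f k ≈ 0#) →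
    ∑[ k ≤ N ] (f k) ≈ ∑[ k ≤ n ] (f k)
  ∑-truncate {N = zero}  f z≤n p = refl
  ∑-truncate {N = suc N} f z≤n p =
    +-congˡ (∑-zero N (λ k → f (suc k)) (λ k k≤N → p (suc k) (s≤s z≤n) (s≤s k≤N)))
  ∑-truncate f (s≤s n≤N) p = +-congˡ
    (∑-truncate (λ k → f (suc k)) n≤N (λ k n<k k≤N → p (suc k) (s≤s n<k) (s≤s k≤N)))

  ⊛-∑ : ∀ N v (b : ℕ → Carrier) (w : ℕ → Series) n →
    (v ⊛ (λ i → ∑[ k ≤ N ] (b k * w k i))) n ≈ ∑[ k ≤ N ] (b k * (v ⊛ w k) n)
  ⊛-∑ zero v b w n = begin
    (v ⊛ (λ i → b 0 * w 0 i + 0#)) n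
      ≈⟨ ⊛-cong-≤ {f = v} {g′ = b 0 • w 0} n (λ _ _ → refl) (λ _ _ → +-identityʳ _) ⟩
    (v ⊛ (b 0 • w 0)) n                ≈⟨ coeff (⊛-• (b 0) v (w 0)) n ⟩
    b 0 * (v ⊛ w 0) n                  ≈⟨ +-identityʳ _ ⟨
    b 0 * (v ⊛ w 0) n + 0#             ∎
  ⊛-∑ (suc N) v b w n = begin
    (v ⊛ ((b 0 • w 0) ⊕ rest)) n
      ≈⟨ coeff (⊛-distribˡ v (b 0 • w 0) rest) n ⟩
    (v ⊛ (b 0 • w 0)) n + (v ⊛ rest) n
      ≈⟨ +-cong (coeff (⊛-• (b 0) v (w 0)) n)
                (⊛-∑ N v (λ k → b (suc k)) (λ k → w (suc k)) n) ⟩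
    b 0 * (v ⊛ w 0) n + ∑[ k ≤ N ] (b (suc k) * (v ⊛ w (suc k)) n)
      ∎
    where
    rest : Series
    rest i = ∑[ k ≤ N ] (b (suc k) * w (suc k) i)

  -- Composition

  -- The k-th power of a series without constant term starts at tᵏ.
  ^ₛ-order : ∀ f k n → n < k → (dropConst f ^ₛ k) n ≈ 0#
  ^ₛ-order f (suc k) zero    _         = trans (+-identityʳ _) (zeroˡ _)
  ^ₛ-order f (suc k) (suc n) (s≤s n<k) = begin
    0# * u^k (suc n) + (u/t ⊛ u^k) n   ≈⟨ +-cong (zeroˡ _) (⊛-comm-coeff n u/t u^k) ⟩
    0# + (u^k ⊛ u/t) n                 ≈⟨ +-identityˡ _ ⟩
    (u^k ⊛ u/t) n                      ≈⟨ ⊛-zeroˡ-coeff u/t n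
                                            (λ i i≤n → ^ₛ-order f k i (ℕₚ.≤-<-trans i≤n n<k)) ⟩
    0#                                 ∎
    where
    u/t u^k : Series
    u/t = dropConst f /t
    u^k = dropConst f ^ₛ k

  -- In the coefficient of tⁿ all the coefficients of the composite may be
  -- summed up to n, since the additional terms vanish.
  ⊛-∘₀ : ∀ v b f n →
    (v ⊛ (b ∘₀ f)) n ≈ ∑[ k ≤ n ] (b k * (v ⊛ dropConst f ^ₛ k) n)
  ⊛-∘₀ v b f n = trans
    (⊛-cong-≤ {f = v} n (λ _ _ → refl) (λ i i≤n → sym (∑-truncate (term i) i≤n (λ k i<k _ →
      trans (*-congˡ (^ₛ-order f k i i<k)) (zeroʳ (b k))))))
    (⊛-∑ n v b (dropConst f ^ₛ_) n)
    where
    term : ℕ → ℕ → Carrier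
    term i k = b k * (dropConst f ^ₛ k) i

  -- Horner's rule a(u) = a₀ + u · (a/t)(u), from which the other rules for
  -- composites follow without further reference to the powers of u.
  horner : ∀ a f → a ∘₀ f ≋ const (a 0) ⊕ dropConst f ⊛ ((a /t) ∘₀ f)
  horner a f = pointwise λ where
      zero    → solve 2 (λ x y → x :* con 1 :+ con 0 := x :+ (con 0 :* y :+ con 0))
                  refl (a 0) (((a /t) ∘₀ f) 0)
      (suc n) → +-cong (zeroʳ (a 0)) (begin
        ∑[ k ≤ n ] (a (suc k) * (0# * (dropConst f ^ₛ k) (suc n) + (u/t ⊛ dropConst f ^ₛ k) n))
          ≈⟨ ∑-cong n (λ k → a (suc k) * (0# * (dropConst f ^ₛ k) (suc n) + (u/t ⊛ dropConst f ^ₛ k) n))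
                      (λ k → a (suc k) * (u/t ⊛ dropConst f ^ₛ k) n)
                      (λ k → *-congˡ (0*x+y≈y _ _)) ⟩
        ∑[ k ≤ n ] (a (suc k) * (u/t ⊛ dropConst f ^ₛ k) n)
          ≈⟨ ⊛-∘₀ u/t (a /t) f n ⟨
        (u/t ⊛ ((a /t) ∘₀ f)) n
          ≈⟨ 0*x+y≈y _ _ ⟨
        0# * ((a /t) ∘₀ f) (suc n) + (u/t ⊛ ((a /t) ∘₀ f)) n
          ∎)
    where
    u/t : Series
    u/t = dropConst f /t

    0*x+y≈y : ∀ x y → 0# * x + y ≈ y
    0*x+y≈y x y = trans (+-congʳ (zeroˡ x)) (+-identityˡ y)

  ∘₀-congˡ : ∀ {a b} f → a ≋ b → a ∘₀ f ≋ b ∘₀ f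
  ∘₀-congˡ {a} {b} f p = pointwise λ n →
    ∑-cong n (λ k → a k * (dropConst f ^ₛ k) n) (λ k → b k * (dropConst f ^ₛ k) n)
      (λ k → *-congʳ (coeff p k))

  ⊕-∘₀ : ∀ a b f → (a ⊕ b) ∘₀ f ≋ (a ∘₀ f) ⊕ (b ∘₀ f)
  ⊕-∘₀ a b f = pointwise λ n →
    let aᵤ k = a k * (dropConst f ^ₛ k) n
        bᵤ k = b k * (dropConst f ^ₛ k) n
    in trans
      (∑-cong n (λ k → (a k + b k) * (dropConst f ^ₛ k) n) (λ k → aᵤ k + bᵤ k)
        (λ k → distribʳ _ (a k) (b k)))
      (∑-+ n aᵤ bᵤ)

  const0-coeff : ∀ n → const 0# n ≈ 0#
  const0-coeff zero    = refl
  const0-coeff (suc _) = refl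

  const0-∘₀ : ∀ f → const 0# ∘₀ f ≋ const 0#
  const0-∘₀ f = pointwise λ n → trans
    (∑-zero n (λ k → const 0# k * (dropConst f ^ₛ k) n)
      (λ k _ → trans (*-congʳ (const0-coeff k)) (zeroˡ _)))
    (sym (const0-coeff n))

  t·-∘₀ : ∀ a f → (t· a) ∘₀ f ≋ dropConst f ⊛ (a ∘₀ f)
  t·-∘₀ a f = ≋-trans (horner (t· a) f) (⊕-identityˡ _)

  ∘₀-constant : ∀ a f → (a ∘₀ f) 0 ≈ a 0
  ∘₀-constant a f = trans (+-identityʳ _) (*-identityʳ _)

  -- The Euler operator

  -- t d/dt.  Unlike d/dt it does not shift the coefficients.
  θ : Series → Series
  θ f n = ι n * f n

  -- d/dt, needed for the outer series of a composite.
  derivative : Series → Series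
  derivative a n = ι (suc n) * a (suc n)

  θ-constant : ∀ f → θ f 0 ≈ 0#
  θ-constant f = zeroˡ (f 0)

  θ-cong : ∀ {f g} → f ≋ g → θ f ≋ θ g
  θ-cong p = pointwise λ n → *-congˡ (coeff p n)

  θ-• : ∀ a f → θ (a • f) ≋ a • θ f
  θ-• a f = pointwise λ n →
    solve 3 (λ i a x → i :* (a :* x) := a :* (i :* x)) refl (ι n) a (f n)

  θ-const⊕ : ∀ a f → θ (const a ⊕ f) ≋ θ f
  θ-const⊕ a f = pointwise λ where
    zero    → trans (zeroˡ _) (sym (zeroˡ _))
    (suc n) → *-congˡ (+-identityˡ _)

  θ-dropConst : ∀ f → θ (dropConst f) ≋ θ f
  θ-dropConst f = pointwise λ where
    zero    → trans (zeroˡ _) (sym (zeroˡ _))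
    (suc n) → refl

  θ-⊛-coeff : ∀ n f g → θ (f ⊛ g) n ≈ (θ f ⊛ g) n + (f ⊛ θ g) n
  θ-⊛-coeff zero f g =
    solve 2 (λ x y → con 0 :* (x :* y :+ con 0)
                     := con 0 :* x :* y :+ con 0 :+ (x :* (con 0 :* y) :+ con 0))
      refl (f 0) (g 0)
  θ-⊛-coeff (suc n) f g = begin
    (1# + ι n) * (f 0 * g (suc n) + X)
      ≈⟨ solve 4 (λ i x y z → (con 1 :+ i) :* (x :* y :+ z)
                              := x :* ((con 1 :+ i) :* y) :+ (z :+ i :* z))
           refl (ι n) (f 0) (g (suc n)) X ⟩
    f 0 * θ g (suc n) + (X + ι n * X)
      ≈⟨ +-congˡ (+-congˡ (θ-⊛-coeff n (f /t) g)) ⟩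
    f 0 * θ g (suc n) + (X + ((θ (f /t) ⊛ g) n + Z))
      ≈⟨ solve 5 (λ a x y z w → a :+ (x :+ (y :+ z)) := con 0 :* w :+ (x :+ y) :+ (a :+ z))
           refl _ X ((θ (f /t) ⊛ g) n) Z (f 0 * g (suc n)) ⟩
    0# * (f 0 * g (suc n)) + (X + (θ (f /t) ⊛ g) n) + (f 0 * θ g (suc n) + Z)
      ≈⟨ +-congʳ (+-cong (sym (*-assoc _ _ _)) (sym (⊛-distribʳ-coeff n g (f /t) (θ (f /t))))) ⟩
    0# * f 0 * g (suc n) + (((f /t) ⊕ θ (f /t)) ⊛ g) n + (f 0 * θ g (suc n) + Z)
      ≈⟨ +-congʳ (+-congˡ (⊛-cong-≤ {g = g} n (λ k _ → θ-/t k) (λ _ _ → refl))) ⟩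
    (θ f ⊛ g) (suc n) + (f ⊛ θ g) (suc n)
      ∎
    where
    X Z : Carrier
    X = ((f /t) ⊛ g) n
    Z = ((f /t) ⊛ θ g) n

    θ-/t : ∀ k → f (suc k) + ι k * f (suc k) ≈ (1# + ι k) * f (suc k)
    θ-/t k = trans (+-congʳ (sym (*-identityˡ _))) (sym (distribʳ _ 1# (ι k)))

  θ-⊛ : ∀ f g → θ (f ⊛ g) ≋ θ f ⊛ g ⊕ f ⊛ θ g
  θ-⊛ f g = pointwise λ n → θ-⊛-coeff n f g

  -- The Leibniz rule for a - a₀ = t · (a/t).
  derivative-/t : ∀ a → derivative a ≋ (a /t) ⊕ t· (derivative (a /t))
  derivative-/t a = pointwise λ where
    zero    → trans (*-congʳ ι1≈1) (trans (*-identityˡ _) (sym (+-identityʳ _)))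
    (suc n) → trans (distribʳ _ 1# (ι (suc n))) (+-congʳ (*-identityˡ _))

  chain-rule : ∀ a f → θ (a ∘₀ f) ≋ (derivative a ∘₀ f) ⊛ θ f
  chain-rule a f = pointwise λ n → below n n a ℕₚ.≤-refl
    where
    u : Series
    u = dropConst f

    -- Horner's rule and the Leibniz rule reduce the claim for a to the claim
    -- for a/t, multiplied by u.
    step : ∀ n a →
      (∀ i → i < n → θ ((a /t) ∘₀ f) i ≈ ((derivative (a /t) ∘₀ f) ⊛ θ f) i) →
      θ (a ∘₀ f) n ≈ ((derivative a ∘₀ f) ⊛ θ f) n
    step n a ih = begin
      θ (a ∘₀ f) n                             ≈⟨ coeff (θ-cong (horner a f)) n ⟩
      θ (const (a 0) ⊕ u ⊛ b) n                ≈⟨ coeff (θ-const⊕ (a 0) (u ⊛ b)) n ⟩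
      θ (u ⊛ b) n                              ≈⟨ coeff (θ-⊛ u b) n ⟩
      (θ u ⊛ b) n + (u ⊛ θ b) n                ≈⟨ +-cong (coeff (⊛-congʳ b (θ-dropConst f)) n)
                                                         (⊛-cong-< u n refl ih) ⟩
      (θ f ⊛ b) n + (u ⊛ (b′ ⊛ θ f)) n         ≈⟨ coeff rearrange n ⟩
      ((b ⊕ u ⊛ b′) ⊛ θ f) n
        ≈⟨ coeff (⊛-congʳ (θ f) (⊕-congˡ b (t·-∘₀ (derivative (a /t)) f))) n ⟨
      ((b ⊕ ((t· derivative (a /t)) ∘₀ f)) ⊛ θ f) n
        ≈⟨ coeff (⊛-congʳ (θ f) (⊕-∘₀ (a /t) (t· derivative (a /t)) f)) n ⟨
      ((((a /t) ⊕ t· derivative (a /t)) ∘₀ f) ⊛ θ f) n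
        ≈⟨ coeff (⊛-congʳ (θ f) (∘₀-congˡ f (derivative-/t a))) n ⟨
      ((derivative a ∘₀ f) ⊛ θ f) n            ∎
      where
      b b′ : Series
      b  = (a /t) ∘₀ f
      b′ = derivative (a /t) ∘₀ f

      rearrange : θ f ⊛ b ⊕ u ⊛ (b′ ⊛ θ f) ≋ (b ⊕ u ⊛ b′) ⊛ θ f
      rearrange = ≋-solve 4
        (λ d b u b′ → d ⊠ b ⊞ u ⊠ (b′ ⊠ d)
                      ⊜ (b ⊞ u ⊠ b′) ⊠ d)
        ≋-refl (θ f) b u b′

    -- Strong induction on n, for all a at once.
    below : ∀ N n a → n ≤ N → θ (a ∘₀ f) n ≈ ((derivative a ∘₀ f) ⊛ θ f) n
    below N       zero    a _         = step 0 a (λ _ ())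
    below (suc N) (suc n) a (s≤s n≤N) =
      step (suc n) a (λ { i (s≤s i≤n) → below N i (a /t) (ℕₚ.≤-trans i≤n n≤N) })

  -- The equation θ y = w y with w₀ = 0 determines y from its constant term:
  -- n yₙ is a combination of the coefficients of y below n.  This is where
  -- characteristic zero is needed.
  θ-unique : ∀ {w y z} → w 0 ≈ 0# → θ y ≋ w ⊛ y → θ z ≋ w ⊛ z → y 0 ≈ z 0 → y ≋ z
  θ-unique {w} {y} {z} w₀≈0 θy θz y₀≈z₀ = pointwise λ n → below n n ℕₚ.≤-refl
    where
    below : ∀ N n → n ≤ N → y n ≈ z n
    below N       zero    _         = y₀≈z₀
    below (suc N) (suc n) (s≤s n≤N) = ι-cancelˡ (suc n) (begin
      θ y (suc n)       ≈⟨ coeff θy (suc n) ⟩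
      (w ⊛ y) (suc n)   ≈⟨ ⊛-cong-< w (suc n) w₀≈0 (λ { i (s≤s i≤n) → below N i (ℕₚ.≤-trans i≤n n≤N) }) ⟩
      (w ⊛ z) (suc n)   ≈⟨ coeff θz (suc n) ⟨
      θ z (suc n)       ∎)

  -- Inverse series

  -- With c = f(0) and u = 1 - f/c, the series c · inverse f is G = 1/(1 - u), and Horner's
  -- rule for G reads G = 1 + u G.
  inverse-inverseʳ : ∀ f (f₀#0 : f 0 # 0#) → f ⊛ inverse f f₀#0 ≋ const 1#
  inverse-inverseʳ f f₀#0 = ⊕-cancelʳ {h = u ⊛ G} (
    f ⊛ (c⁻¹ • G) ⊕ u ⊛ G       ≋⟨ ⊕-congʳ (u ⊛ G) (≋-trans (⊛-• c⁻¹ f G) (≋-sym (•-⊛ c⁻¹ f G))) ⟩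
    (c⁻¹ • f) ⊛ G ⊕ u ⊛ G       ≋⟨ ⊛-distribʳ G (c⁻¹ • f) u ⟨
    ((c⁻¹ • f) ⊕ u) ⊛ G         ≋⟨ ⊛-congʳ G f/c+u≋1 ⟩
    const 1# ⊛ G                ≋⟨ ⊛-identityˡ G ⟩
    G                           ≋⟨ horner (λ _ → 1#) ((- c⁻¹) • f) ⟩
    const 1# ⊕ u ⊛ G            □)
    where
    c⁻¹ : Carrier
    c⁻¹ = recip f₀#0

    u G : Series
    u = dropConst ((- c⁻¹) • f)
    G = (λ _ → 1#) ∘₀ ((- c⁻¹) • f)

    f/c+u≋1 : (c⁻¹ • f) ⊕ u ≋ const 1#
    f/c+u≋1 = pointwise λ where
      zero    → trans (+-identityʳ _) (trans (*-comm _ _) (*-recip f₀#0))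
      (suc n) → trans (sym (distribʳ _ _ _)) (trans (*-congʳ (-‿inverseʳ c⁻¹)) (zeroˡ _))

  -- Exponential, logarithm and powers of a series

  ι-suc*1/suc! : ∀ k → ι (suc k) * 1/ suc k ! ≈ 1/ k !
  ι-suc*1/suc! k =
    trans (fraction-cong {suc k} {suc k !} {1} {k !} {{suc k ℕₚ.!≢0}} {{k ℕₚ.!≢0}}
             (≡.sym (ℕₚ.*-identityˡ (suc k !))))
          (trans (*-congʳ ι1≈1) (*-identityˡ _))

  derivative-exp : derivative (exp-t 1#) ≋ exp-t 1#
  derivative-exp = pointwise λ k →
    trans (solve 4 (λ i x y z → i :* (x :* y :* z) := x :* y :* (i :* z)) refl
             (ι (suc k)) 1# (1# ^ k) (1/ suc k !))
          (*-cong (*-identityˡ _) (ι-suc*1/suc! k))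

  expₛ-constant : ∀ f → expₛ f 0 ≈ exp (f 0)
  expₛ-constant f = trans (*-congˡ (∘₀-constant (exp-t 1#) f)) (x*exp₀≈x _)

  θ-expₛ : ∀ f → θ (expₛ f) ≋ θ f ⊛ expₛ f
  θ-expₛ f =
    θ (exp (f 0) • E)                         ≋⟨ θ-• (exp (f 0)) E ⟩
    exp (f 0) • θ E                           ≋⟨ •-cong refl (chain-rule (exp-t 1#) f) ⟩
    exp (f 0) • ((derivative (exp-t 1#) ∘₀ f) ⊛ θ f)
      ≋⟨ •-cong refl (⊛-congʳ (θ f) (∘₀-congˡ f derivative-exp)) ⟩
    exp (f 0) • (E ⊛ θ f)                     ≋⟨ •-cong refl (⊛-comm E (θ f)) ⟩
    exp (f 0) • (θ f ⊛ E)                     ≋⟨ ⊛-• (exp (f 0)) (θ f) E ⟨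
    θ f ⊛ expₛ f                              □
    where
    E : Series
    E = exp-t 1# ∘₀ f

  derivative-log : ∀ k → derivative log[1+t] k ≈ (- 1#) ^ k
  derivative-log k =
    trans (solve 3 (λ i x y → i :* (x :* y) := x :* (i :* y)) refl (ι (suc k)) _ _)
          (trans (*-congˡ (ι*1/ι≈1 (suc k))) (*-identityʳ _))

  module _ (f : Series) (L : Logarithm (f 0)) where
    open Logarithm L

    logₛ-constant : logₛ f L 0 ≈ value
    logₛ-constant =
      trans (+-congˡ (∘₀-constant log[1+t] (exp (- value) • f))) (+-identityʳ value)

    exp[-value]*f₀≈1 : exp (- value) * f 0 ≈ 1#
    exp[-value]*f₀≈1 = begin
      exp (- value) * f 0         ≈⟨ *-congˡ exp-value ⟨
      exp (- value) * exp value   ≈⟨ exp-+ _ _ ⟨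
      exp (- value + value)       ≈⟨ exp-cong (-‿inverseˡ value) ⟩
      exp 0#                      ≈⟨ exp-0 ⟩
      1#                          ∎

    -- The derivative D of log (1 + t) has constant term 1 and satisfies
    -- D + (D - 1)/t = 0, that is (1 + t) D = 1.  So its composite with f/c - 1,
    -- where c = f(0), is the inverse of f/c.
    θ-logₛ : θ (logₛ f L) ⊛ f ≋ θ f
    θ-logₛ =
      θ (const value ⊕ (log[1+t] ∘₀ e•f)) ⊛ f   ≋⟨ ⊛-congʳ f (θ-const⊕ value (log[1+t] ∘₀ e•f)) ⟩
      θ (log[1+t] ∘₀ e•f) ⊛ f                   ≋⟨ ⊛-congʳ f (chain-rule log[1+t] e•f) ⟩
      (G ⊛ θ e•f) ⊛ f                           ≋⟨ ⊛-congʳ f (⊛-congˡ G (θ-• e f)) ⟩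
      (G ⊛ (e • θ f)) ⊛ f                       ≋⟨ ⊛-congʳ f (⊛-congˡ G (≋-sym (const-⊛ e (θ f)))) ⟩
      (G ⊛ (const e ⊛ θ f)) ⊛ f                 ≋⟨ rearrange ⟩
      θ f ⊛ ((const e ⊛ f) ⊛ G)                 ≋⟨ ⊛-congˡ (θ f) (⊛-congʳ G (const-⊛ e f)) ⟩
      θ f ⊛ (e•f ⊛ G)                           ≋⟨ ⊛-congˡ (θ f) e•f⊛G≋1 ⟩
      θ f ⊛ const 1#                            ≋⟨ ⊛-identityʳ (θ f) ⟩
      θ f                                       □
      where
      e : Carrier
      e = exp (- value)

      e•f u D G G′ : Series
      e•f = e • f
      u   = dropConst e•f
      D   = derivative log[1+t]
      G   = D ∘₀ e•f
      G′  = (D /t) ∘₀ e•f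

      rearrange : (G ⊛ (const e ⊛ θ f)) ⊛ f ≋ θ f ⊛ ((const e ⊛ f) ⊛ G)
      rearrange = ≋-solve 4
        (λ g k d h → g ⊠ (k ⊠ d) ⊠ h
                     ⊜ d ⊠ (k ⊠ h ⊠ g))
        ≋-refl G (const e) (θ f) f

      e•f≋1+u : e•f ≋ const 1# ⊕ u
      e•f≋1+u = pointwise λ where
        zero    → trans exp[-value]*f₀≈1 (sym (+-identityʳ 1#))
        (suc n) → sym (+-identityˡ _)

      D+D/t≋0 : D ⊕ (D /t) ≋ const 0#
      D+D/t≋0 = pointwise λ k → trans
        (+-cong (trans (derivative-log k) (sym (*-identityˡ _))) (derivative-log (suc k)))
        (trans (sym (distribʳ _ _ _))
          (trans (*-congʳ (-‿inverseʳ 1#)) (trans (zeroˡ _) (sym (const0-coeff k)))))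

      D₀≈1 : D 0 ≈ 1#
      D₀≈1 = derivative-log 0

      e•f⊛G≋1 : e•f ⊛ G ≋ const 1#
      e•f⊛G≋1 =
        e•f ⊛ G                             ≋⟨ ⊛-congʳ G e•f≋1+u ⟩
        (const 1# ⊕ u) ⊛ G                  ≋⟨ ⊛-distribʳ G (const 1#) u ⟩
        const 1# ⊛ G ⊕ u ⊛ G                ≋⟨ ⊕-congʳ (u ⊛ G) (⊛-identityˡ G) ⟩
        G ⊕ u ⊛ G                           ≋⟨ ⊕-congʳ (u ⊛ G) (horner D e•f) ⟩
        const (D 0) ⊕ u ⊛ G′ ⊕ u ⊛ G        ≋⟨ ≋-solve 4
                                                 (λ c u g g′ → c ⊞ u ⊠ g′ ⊞ u ⊠ g
                                                   ⊜ c ⊞ u ⊠ (g ⊞ g′))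
                                                 ≋-refl (const (D 0)) u G G′ ⟩
        const (D 0) ⊕ u ⊛ (G ⊕ G′)          ≋⟨ ⊕-congˡ (const (D 0)) (⊛-congˡ u (≋-sym (⊕-∘₀ D (D /t) e•f))) ⟩
        const (D 0) ⊕ u ⊛ ((D ⊕ (D /t)) ∘₀ e•f)
          ≋⟨ ⊕-congˡ (const (D 0)) (⊛-congˡ u (≋-trans (∘₀-congˡ e•f D+D/t≋0) (const0-∘₀ e•f))) ⟩
        const (D 0) ⊕ u ⊛ const 0#          ≋⟨ ⊕-congˡ (const (D 0)) (⊛-zeroʳ u) ⟩
        const (D 0) ⊕ const 0#              ≋⟨ ⊕-identityʳ (const (D 0)) ⟩
        const (D 0)                         ≋⟨ (pointwise λ { zero → D₀≈1 ; (suc _) → refl }) ⟩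
        const 1#                            □

    pow-constant : ∀ α → pow f L α 0 ≈ exp (α * value)
    pow-constant α =
      trans (expₛ-constant (α • logₛ f L)) (exp-cong (*-congˡ logₛ-constant))

    -- Both sides satisfy θ y = (α + 1) θ(log f) y, because θ f = θ(log f) f.
    pow-suc : ∀ α → pow f L (α + 1#) ≋ f ⊛ pow f L α
    pow-suc α = θ-unique {w = θ ((α + 1#) • ℓ)} (θ-constant ((α + 1#) • ℓ))
      (θ-expₛ ((α + 1#) • ℓ)) equation constant
      where
      ℓ y : Series
      ℓ = logₛ f L
      y = pow f L α

      θ[[α+1]ℓ] : const α ⊛ θ ℓ ⊕ θ ℓ ≋ θ ((α + 1#) • ℓ)
      θ[[α+1]ℓ] = pointwise λ n → trans
        (+-cong (coeff (const-⊛ α (θ ℓ)) n) (sym (*-identityˡ _)))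
        (trans (sym (distribʳ _ α 1#)) (sym (coeff (θ-• (α + 1#) ℓ) n)))

      equation : θ (f ⊛ y) ≋ θ ((α + 1#) • ℓ) ⊛ (f ⊛ y)
      equation =
        θ (f ⊛ y)                                      ≋⟨ θ-⊛ f y ⟩
        θ f ⊛ y ⊕ f ⊛ θ y
          ≋⟨ ⊕-cong (⊛-congʳ y (≋-sym θ-logₛ)) (⊛-congˡ f (θ-expₛ (α • ℓ))) ⟩
        (θ ℓ ⊛ f) ⊛ y ⊕ f ⊛ (θ (α • ℓ) ⊛ y)            ≋⟨ ⊕-congˡ ((θ ℓ ⊛ f) ⊛ y) (⊛-congˡ f (⊛-congʳ y
                                                            (≋-trans (θ-• α ℓ) (≋-sym (const-⊛ α (θ ℓ)))))) ⟩
        (θ ℓ ⊛ f) ⊛ y ⊕ f ⊛ ((const α ⊛ θ ℓ) ⊛ y)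
          ≋⟨ ≋-solve 4
               (λ d f y a → d ⊠ f ⊠ y ⊞ f ⊠ (a ⊠ d ⊠ y)
                 ⊜ (a ⊠ d ⊞ d) ⊠ (f ⊠ y))
               ≋-refl (θ ℓ) f y (const α) ⟩
        (const α ⊛ θ ℓ ⊕ θ ℓ) ⊛ (f ⊛ y)                ≋⟨ ⊛-congʳ (f ⊛ y) θ[[α+1]ℓ] ⟩
        θ ((α + 1#) • ℓ) ⊛ (f ⊛ y)                     □

      constant : pow f L (α + 1#) 0 ≈ (f ⊛ y) 0
      constant = begin
        pow f L (α + 1#) 0              ≈⟨ pow-constant (α + 1#) ⟩
        exp ((α + 1#) * value)
          ≈⟨ exp-cong (solve 2 (λ a v → (a :+ con 1) :* v := v :+ a :* v) refl α value) ⟩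
        exp (value + α * value)         ≈⟨ exp-+ _ _ ⟩
        exp value * exp (α * value)     ≈⟨ *-cong exp-value (sym (pow-constant α)) ⟩
        f 0 * y 0                       ≈⟨ +-identityʳ _ ⟨
        f 0 * y 0 + 0#                  ∎

  -- The Padé approximants of the exponential

  -- Multiplication by t^N.
  infixr 20 t^_·_
  t^_·_ : ℕ → Series → Series
  t^ zero  · f = f
  t^ suc N · f = t· (t^ N · f)

  t^-cong : ∀ N {f g} → f ≋ g → t^ N · f ≋ t^ N · g
  t^-cong zero    p = p
  t^-cong (suc N) p = t·-cong (t^-cong N p)

  t^-congʳ : ∀ {M N f} → M ≡ N → t^ M · f ≋ t^ N · f
  t^-congʳ ≡.refl = ≋-refl

  t·-⊕ : ∀ f g → t· (f ⊕ g) ≋ t· f ⊕ t· g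
  t·-⊕ f g = pointwise λ where
    zero    → sym (+-identityˡ 0#)
    (suc n) → refl

  t^-⊕ : ∀ N f g → t^ N · (f ⊕ g) ≋ t^ N · f ⊕ t^ N · g
  t^-⊕ zero    f g = ≋-refl
  t^-⊕ (suc N) f g = ≋-trans (t·-cong (t^-⊕ N f g)) (t·-⊕ (t^ N · f) (t^ N · g))

  t^-⊛ : ∀ N f g → t^ N · f ⊛ g ≋ t^ N · (f ⊛ g)
  t^-⊛ zero    f g = ≋-refl
  t^-⊛ (suc N) f g = ≋-trans (t·-⊛ (t^ N · f) g) (t·-cong (t^-⊛ N f g))

  t^-coeff-< : ∀ {N k} f → k < N → (t^ N · f) k ≈ 0#
  t^-coeff-< {suc N} {zero}  f _         = refl
  t^-coeff-< {suc N} {suc k} f (s≤s k<N) = t^-coeff-< f k<N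

  t^-coeff-≥ : ∀ N f k → (t^ N · f) (N ℕ.+ k) ≈ f k
  t^-coeff-≥ zero    f k = refl
  t^-coeff-≥ (suc N) f k = t^-coeff-≥ N f k

  -- The three families obey X(n,m+1) + t X(n,m) = X(n+1,m).  For γ the factor t
  -- is absorbed by the power t^(m+n+1) that multiplies it in the remainder.

  coeffα-rec : ∀ n m → coeffα n (suc m) ⊕ t· coeffα n m ≋ coeffα (suc n) m
  coeffα-rec n m = pointwise λ where
      zero    → trans (+-identityʳ _) (ι-cong (≡.cong (λ k → 1 ℕ.* k !) (ℕₚ.+-suc n m)))
      (suc j) → trans (sym (ι-+ ((n C suc j) ℕ.* (n ℕ.+ suc m ∸ suc j) !) _)) (ι-cong (pascal j))
    where
    pascal : ∀ j →
      (n C suc j) ℕ.* (n ℕ.+ suc m ∸ suc j) ! ℕ.+ (n C j) ℕ.* (n ℕ.+ m ∸ j) !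
        ≡ (suc n C suc j) ℕ.* (n ℕ.+ m ∸ j) !
    pascal j rewrite ℕₚ.+-suc n m | ≡.sym (nCk+nC[k+1]≡[n+1]C[k+1] n j) =
      ≡.trans (≡.sym (ℕₚ.*-distribʳ-+ _ (n C suc j) (n C j)))
        (≡.cong (ℕ._* (n ℕ.+ m ∸ j) !) (ℕₚ.+-comm (n C suc j) (n C j)))

  coeffβ-rec : ∀ n m → coeffβ n (suc m) ⊕ t· coeffβ n m ≋ coeffβ (suc n) m
  coeffβ-rec n m = pointwise λ where
      zero    → trans (+-identityʳ _)
        (*-congˡ (ι-cong (≡.cong (λ k → 1 ℕ.* k !) (ℕₚ.+-suc n m))))
      (suc j) → begin
        - 1# * (- 1#) ^ j * ι ((suc m C suc j) ℕ.* (n ℕ.+ suc m ∸ suc j) !) + (- 1#) ^ j * A j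
          ≈⟨ +-congʳ (*-congˡ (trans (ι-cong (pascal j)) (ι-+ ((m C j) ℕ.* (n ℕ.+ m ∸ j) !) _))) ⟩
        - 1# * (- 1#) ^ j * (A j + B j) + (- 1#) ^ j * A j
          ≈⟨ solve 4 (λ e s a b → e :* s :* (a :+ b) :+ s :* a
                                  := (e :+ con 1) :* (s :* a) :+ e :* s :* b)
               refl (- 1#) ((- 1#) ^ j) (A j) (B j) ⟩
        (- 1# + 1#) * ((- 1#) ^ j * A j) + - 1# * (- 1#) ^ j * B j
          ≈⟨ +-congʳ (trans (*-congʳ (-‿inverseˡ 1#)) (zeroˡ _)) ⟩
        0# + - 1# * (- 1#) ^ j * B j
          ≈⟨ +-identityˡ _ ⟩
        - 1# * (- 1#) ^ j * B j
          ∎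
    where
    A B : ℕ → Carrier
    A j = ι ((m C j) ℕ.* (n ℕ.+ m ∸ j) !)
    B j = ι ((m C suc j) ℕ.* (n ℕ.+ m ∸ j) !)

    pascal : ∀ j → (suc m C suc j) ℕ.* (n ℕ.+ suc m ∸ suc j) !
      ≡ (m C j) ℕ.* (n ℕ.+ m ∸ j) ! ℕ.+ (m C suc j) ℕ.* (n ℕ.+ m ∸ j) !
    pascal j rewrite ℕₚ.+-suc n m | ≡.sym (nCk+nC[k+1]≡[n+1]C[k+1] m j) =
      ℕₚ.*-distribʳ-+ _ (m C j) (m C suc j)

  coeffγ-rec : ∀ n m → coeffγ n (suc m) ⊕ coeffγ n m ≋ coeffγ (suc n) m
  coeffγ-rec n m = pointwise λ j → begin
    - 1# * s * (ι (A j) * 1/d j) + coeffγ n m j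
      ≈⟨ +-congˡ (*-congˡ (fraction-cong {B j} {b j} {A j ℕ.+ C′ j} {d j} {{b≢0 j}} {{d≢0 j}} (cross j))) ⟩
    - 1# * s * (ι (A j) * 1/d j) + s * (ι (A j ℕ.+ C′ j) * 1/d j)
      ≈⟨ +-congˡ (*-congˡ (*-congʳ (ι-+ (A j) (C′ j)))) ⟩
    - 1# * s * (ι (A j) * 1/d j) + s * ((ι (A j) + ι (C′ j)) * 1/d j)
      ≈⟨ solve 5 (λ e s a c x → e :* s :* (a :* x) :+ s :* ((a :+ c) :* x)
                                := (e :+ con 1) :* (s :* (a :* x)) :+ s :* (c :* x))
           refl (- 1#) s (ι (A j)) (ι (C′ j)) (1/d j) ⟩
    (- 1# + 1#) * (s * (ι (A j) * 1/d j)) + s * (ι (C′ j) * 1/d j)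
      ≈⟨ +-congʳ (trans (*-congʳ (-‿inverseˡ 1#)) (zeroˡ _)) ⟩
    0# + s * (ι (C′ j) * 1/d j)
      ≈⟨ +-identityˡ _ ⟩
    s * (ι (C′ j) * 1/d j)
      ≈⟨ *-congˡ (fraction-cong {C′ j} {d j} {C′ j} {d′ j} {{d≢0 j}} {{d′≢0 j}} (≡.cong (C′ j ℕ.*_) (d′≡d j))) ⟩
    coeffγ (suc n) m j
      ∎
    where
    s : Carrier
    s = (- 1#) ^ m

    A B C′ b d d′ : ℕ → ℕ
    A  j = n ! ℕ.* (suc m ℕ.+ j) !
    B  j = n ! ℕ.* (m ℕ.+ j) !
    C′ j = suc n ! ℕ.* (m ℕ.+ j) !
    b  j = (m ℕ.+ n ℕ.+ 1 ℕ.+ j) ! ℕ.* j !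
    d  j = (suc m ℕ.+ n ℕ.+ 1 ℕ.+ j) ! ℕ.* j !
    d′ j = (m ℕ.+ suc n ℕ.+ 1 ℕ.+ j) ! ℕ.* j !

    b≢0 : ∀ j → ℕ.NonZero (b j)
    b≢0 j = ℕₚ.m*n≢0 _ _ {{(m ℕ.+ n ℕ.+ 1 ℕ.+ j) ℕₚ.!≢0}} {{j ℕₚ.!≢0}}

    d≢0 : ∀ j → ℕ.NonZero (d j)
    d≢0 j = ℕₚ.m*n≢0 _ _ {{(suc m ℕ.+ n ℕ.+ 1 ℕ.+ j) ℕₚ.!≢0}} {{j ℕₚ.!≢0}}

    d′≢0 : ∀ j → ℕ.NonZero (d′ j)
    d′≢0 j = ℕₚ.m*n≢0 _ _ {{(m ℕ.+ suc n ℕ.+ 1 ℕ.+ j) ℕₚ.!≢0}} {{j ℕₚ.!≢0}}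

    1/d : ℕ → Carrier
    1/d j = 1/ι (d j) {{d≢0 j}}

    d′≡d : ∀ j → d′ j ≡ d j
    d′≡d j = ≡.cong (λ k → (k ℕ.+ 1 ℕ.+ j) ! ℕ.* j !) (ℕₚ.+-suc m n)

    -- (m+n+2+j) n! (m+j)! = n! (m+1+j)! + (n+1)! (m+j)!, times (m+n+1+j)! j!
    cross : ∀ j → B j ℕ.* d j ≡ (A j ℕ.+ C′ j) ℕ.* b j
    cross j = +-*-Solver.solve 7
      (λ m n j n! [m+j]! [m+n+1+j]! j! →
        n! ⊗ [m+j]! ⊗ ((𝟏 ∔ (m ∔ n ∔ 𝟏 ∔ j)) ⊗ [m+n+1+j]! ⊗ j!)
        ≐ (n! ⊗ ((𝟏 ∔ (m ∔ j)) ⊗ [m+j]!) ∔ (𝟏 ∔ n) ⊗ n! ⊗ [m+j]!) ⊗ ([m+n+1+j]! ⊗ j!))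
      ≡.refl m n j (n !) ((m ℕ.+ j) !) ((m ℕ.+ n ℕ.+ 1 ℕ.+ j) !) (j !)
      where
      open +-*-Solver using ()
        renaming (_:+_ to infixl 6 _∔_; _:*_ to infixl 7 _⊗_; _:=_ to infix 4 _≐_)
      𝟏 = +-*-Solver.con 1

  exp-t1-coeff : ∀ k → exp-t 1# k ≈ 1/ k !
  exp-t1-coeff k = trans (*-congʳ (1^k≈1 k)) (*-identityˡ _)
    where
    1^k≈1 : ∀ k → 1# ^ k ≈ 1#
    1^k≈1 zero    = refl
    1^k≈1 (suc k) = trans (*-identityˡ _) (1^k≈1 k)

  coeffα-vanishes : ∀ {n j} m → n < j → coeffα n m j ≈ 0#
  coeffα-vanishes {n} {j} m n<j = ι-cong (≡.cong (ℕ._* (n ℕ.+ m ∸ j) !) (k>n⇒nCk≡0 n<j))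

  coeffβ-vanishes : ∀ {m j} n → m < j → coeffβ n m j ≈ 0#
  coeffβ-vanishes {m} {j} n m<j =
    trans (*-congˡ (ι-cong (≡.cong (ℕ._* (n ℕ.+ m ∸ j) !) (k>n⇒nCk≡0 m<j)))) (zeroʳ _)

  nCk*[n-k]!*k!≡n! : ∀ {n k} → k ≤ n → (n C k) ℕ.* (n ∸ k) ! ℕ.* k ! ≡ n !
  nCk*[n-k]!*k!≡n! {n} {k} k≤n = ≡.trans
    (≡.trans (ℕₚ.*-assoc (n C k) _ _) (≡.cong ((n C k) ℕ.*_) (ℕₚ.*-comm ((n ∸ k) !) (k !))))
    (≡.trans (≡.cong (ℕ._* (k ! ℕ.* (n ∸ k) !)) (nCk≡n!/k![n-k]! k≤n))
      (m/n*n≡m {{k ℕₚ.!* (n ∸ k) !≢0}} (k![n∸k]!∣n! k≤n)))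

  -- For m = 0 the polynomial β is the constant n!, while α and the remainder
  -- are the two parts of n! eᵗ.
  padé-zero : ∀ n → coeffβ n 0 ⊛ exp-t 1# ≋ coeffα n 0 ⊕ t^ suc n · coeffγ n 0
  padé-zero n =
    coeffβ n 0 ⊛ exp-t 1#                     ≋⟨ ⊛-congʳ (exp-t 1#) constant ⟩
    const (ι (n !)) ⊛ exp-t 1#                ≋⟨ const-⊛ (ι (n !)) (exp-t 1#) ⟩
    ι (n !) • exp-t 1#                        ≋⟨ (pointwise λ k → trans (*-congˡ (exp-t1-coeff k)) (split k)) ⟩
    coeffα n 0 ⊕ t^ suc n · coeffγ n 0        □
    where
    constant : coeffβ n 0 ≋ const (ι (n !))
    constant = pointwise λ where
      zero    → trans (*-identityˡ _) (ι-cong (≡.trans (ℕₚ.*-identityˡ _)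
                  (≡.cong _! (ℕₚ.+-identityʳ n))))
      (suc j) → coeffβ-vanishes {0} {suc j} n (s≤s z≤n)

    low : ∀ {k} → k ≤ n → ι (n !) * 1/ k ! ≈ coeffα n 0 k
    low {k} k≤n = sym (integer-fraction {(n C k) ℕ.* (n ℕ.+ 0 ∸ k) !} {n !} {k !} {{k ℕₚ.!≢0}}
      (≡.trans (≡.cong (λ l → (n C k) ℕ.* (l ∸ k) ! ℕ.* k !) (ℕₚ.+-identityʳ n))
        (nCk*[n-k]!*k!≡n! k≤n)))

    high : ∀ i → ι (n !) * 1/ (suc n ℕ.+ i) ! ≈ coeffγ n 0 i
    high i = trans
      (fraction-cong {n !} {(suc n ℕ.+ i) !} {n ! ℕ.* i !} {(n ℕ.+ 1 ℕ.+ i) ! ℕ.* i !}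
        {{(suc n ℕ.+ i) ℕₚ.!≢0}}
        {{ℕₚ.m*n≢0 _ _ {{(n ℕ.+ 1 ℕ.+ i) ℕₚ.!≢0}} {{i ℕₚ.!≢0}}}} cross)
      (sym (*-identityˡ _))
      where
      cross : n ! ℕ.* ((n ℕ.+ 1 ℕ.+ i) ! ℕ.* i !) ≡ n ! ℕ.* i ! ℕ.* (suc n ℕ.+ i) !
      cross = ≡.trans
        (≡.cong (λ k → n ! ℕ.* ((k ℕ.+ i) ! ℕ.* i !)) (ℕₚ.+-comm n 1))
        (≡.trans (≡.cong (n ! ℕ.*_) (ℕₚ.*-comm ((suc n ℕ.+ i) !) (i !)))
          (≡.sym (ℕₚ.*-assoc (n !) (i !) _)))

    split : ∀ k → ι (n !) * 1/ k ! ≈ coeffα n 0 k + (t^ suc n · coeffγ n 0) k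
    split k with ℕₚ.≤-<-connex k n
    ... | inj₁ k≤n = trans (low k≤n)
      (trans (sym (+-identityʳ _)) (+-congˡ (sym (t^-coeff-< (coeffγ n 0) (s≤s k≤n)))))
    ... | inj₂ n<k with ℕₚ.m≤n⇒∃[o]m+o≡n n<k
    ...   | i , ≡.refl = trans (high i) (trans (sym (+-identityˡ _))
      (+-cong (sym (coeffα-vanishes 0 n<k)) (sym (t^-coeff-≥ (suc n) (coeffγ n 0) i))))

  -- α / β is the Padé approximant of eᵗ of type (n, m), with remainder
  -- t^(m+n+1) γ / β.
  padé : ∀ n m → coeffβ n m ⊛ exp-t 1# ≋ coeffα n m ⊕ t^ suc (m ℕ.+ n) · coeffγ n m
  padé n zero    = padé-zero n
  padé n (suc m) = ⊕-cancelʳ {h = t· (β m ⊛ e)} (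
    β (suc m) ⊛ e ⊕ t· (β m ⊛ e)                    ≋⟨ ⊕-congˡ (β (suc m) ⊛ e) (t·-⊛ (β m) e) ⟨
    β (suc m) ⊛ e ⊕ t· β m ⊛ e                      ≋⟨ ⊛-distribʳ e (β (suc m)) (t· β m) ⟨
    (β (suc m) ⊕ t· β m) ⊛ e                        ≋⟨ ⊛-congʳ e (coeffβ-rec n m) ⟩
    coeffβ (suc n) m ⊛ e                            ≋⟨ padé (suc n) m ⟩
    coeffα (suc n) m ⊕ t^ suc (m ℕ.+ suc n) · coeffγ (suc n) m
                                                    ≋⟨ ⊕-cong (coeffα-rec n m) remainder ⟨
    (α (suc m) ⊕ t· α m) ⊕ (ρ (suc m) ⊕ t· ρ m)     ≋⟨ rearrange ⟩
    (α (suc m) ⊕ ρ (suc m)) ⊕ (t· α m ⊕ t· ρ m)     ≋⟨ ⊕-congˡ (α (suc m) ⊕ ρ (suc m)) (t·-⊕ (α m) (ρ m)) ⟨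
    (α (suc m) ⊕ ρ (suc m)) ⊕ t· (α m ⊕ ρ m)        ≋⟨ ⊕-congˡ (α (suc m) ⊕ ρ (suc m)) (t·-cong (padé n m)) ⟨
    (α (suc m) ⊕ ρ (suc m)) ⊕ t· (β m ⊛ e)          □)
    where
    e : Series
    e = exp-t 1#

    α β ρ : ℕ → Series
    α m = coeffα n m
    β m = coeffβ n m
    ρ m = t^ suc (m ℕ.+ n) · coeffγ n m

    remainder : ρ (suc m) ⊕ t· ρ m ≋ t^ suc (m ℕ.+ suc n) · coeffγ (suc n) m
    remainder =
      ρ (suc m) ⊕ t· ρ m
        ≋⟨ t^-⊕ (suc (suc (m ℕ.+ n))) (coeffγ n (suc m)) (coeffγ n m) ⟨
      t^ suc (suc (m ℕ.+ n)) · (coeffγ n (suc m) ⊕ coeffγ n m)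
                                                       ≋⟨ t^-cong (suc (suc (m ℕ.+ n))) (coeffγ-rec n m) ⟩
      t^ suc (suc (m ℕ.+ n)) · coeffγ (suc n) m        ≋⟨ t^-congʳ (≡.cong suc (≡.sym (ℕₚ.+-suc m n))) ⟩
      t^ suc (m ℕ.+ suc n) · coeffγ (suc n) m          □

    rearrange : (α (suc m) ⊕ t· α m) ⊕ (ρ (suc m) ⊕ t· ρ m)
      ≋ (α (suc m) ⊕ ρ (suc m)) ⊕ (t· α m ⊕ t· ρ m)
    rearrange = ≋-solve 4
      (λ w x y z → w ⊞ x ⊞ (y ⊞ z)
                   ⊜ w ⊞ y ⊞ (x ⊞ z))
      ≋-refl (α (suc m)) (t· α m) (ρ (suc m)) (t· ρ m)

  -- The relation between series

  -- For (λ eᵗ + s) F = K, multiplying the Padé identity by F gives the relation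
  -- between the coefficients of F and K.
  padé-relation : ∀ n m λ′ s {F K} → ((λ′ • exp-t 1#) ⊕ const s) ⊛ F ≋ K →
    ((λ′ • coeffα n m) ⊕ (s • coeffβ n m)) ⊛ F
        ⊕ λ′ • (t^ suc (m ℕ.+ n) · (coeffγ n m ⊛ F))
      ≋ coeffβ n m ⊛ K
  padé-relation n m λ′ s {F} {K} eq =
    ((λ′ • α) ⊕ (s • β)) ⊛ F ⊕ λ′ • (t^ N · (γ ⊛ F))
      ≋⟨ ⊕-cong (⊛-congʳ F (⊕-cong (≋-sym (const-⊛ λ′ α)) (≋-sym (const-⊛ s β))))
                (≋-trans (•-cong refl (≋-sym (t^-⊛ N γ F))) (≋-sym (const-⊛ λ′ (t^ N · γ ⊛ F)))) ⟩
    (const λ′ ⊛ α ⊕ const s ⊛ β) ⊛ F ⊕ const λ′ ⊛ (t^ N · γ ⊛ F)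
      ≋⟨ collect (const λ′) α (t^ N · γ) (const s) β F ⟩
    (const λ′ ⊛ (α ⊕ t^ N · γ) ⊕ const s ⊛ β) ⊛ F
      ≋⟨ ⊛-congʳ F (⊕-congʳ (const s ⊛ β) (⊛-congˡ (const λ′) (padé n m))) ⟨
    (const λ′ ⊛ (β ⊛ exp-t 1#) ⊕ const s ⊛ β) ⊛ F
      ≋⟨ factor (const λ′) β (exp-t 1#) (const s) F ⟩
    β ⊛ ((const λ′ ⊛ exp-t 1# ⊕ const s) ⊛ F)
      ≋⟨ ⊛-congˡ β (⊛-congʳ F (⊕-congʳ (const s) (const-⊛ λ′ (exp-t 1#)))) ⟩
    β ⊛ (((λ′ • exp-t 1#) ⊕ const s) ⊛ F)
      ≋⟨ ⊛-congˡ β eq ⟩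
    β ⊛ K
      □
    where
    N : ℕ
    N = suc (m ℕ.+ n)

    α β γ : Series
    α = coeffα n m
    β = coeffβ n m
    γ = coeffγ n m

    collect : ∀ l a r s b f → (l ⊛ a ⊕ s ⊛ b) ⊛ f ⊕ l ⊛ (r ⊛ f) ≋ (l ⊛ (a ⊕ r) ⊕ s ⊛ b) ⊛ f
    collect = ≋-solve 6 (λ l a r s b f →
      (l ⊠ a ⊞ s ⊠ b) ⊠ f ⊞ l ⊠ (r ⊠ f) ⊜ (l ⊠ (a ⊞ r) ⊞ s ⊠ b) ⊠ f) ≋-refl

    factor : ∀ l b e s f → (l ⊛ (b ⊛ e) ⊕ s ⊛ b) ⊛ f ≋ b ⊛ ((l ⊛ e ⊕ s) ⊛ f)
    factor = ≋-solve 5 (λ l b e s f →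
      (l ⊠ (b ⊠ e) ⊞ s ⊠ b) ⊠ f ⊜ b ⊠ ((l ⊠ e ⊞ s) ⊠ f)) ≋-refl

  -- The coefficient of t to an integer power, zero when the exponent is negative.
  _at_ : Series → ℤ → Carrier
  f at (+ k)    = f k
  f at -[1+ _ ] = 0#

  at-⊖-suc : ∀ f p j → f at (p ⊖ suc j) ≈ (t· f) at (p ⊖ j)
  at-⊖-suc f zero    zero    = refl
  at-⊖-suc f zero    (suc j) = refl
  at-⊖-suc f (suc p) zero    = reflexive (≡.cong (f at_) (ℤₚ.[1+m]⊖[1+n]≡m⊖n p 0))
  at-⊖-suc f (suc p) (suc j)
    rewrite ℤₚ.[1+m]⊖[1+n]≡m⊖n p (suc j) | ℤₚ.[1+m]⊖[1+n]≡m⊖n p j = at-⊖-suc f p j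

  -- A convolution may be summed over any range that covers the nonzero
  -- coefficients of its first factor.
  ∑-at : ∀ N p (a f : Series) → (∀ j → N < j → j ≤ p → a j ≈ 0#) →
    ∑[ j ≤ N ] (a j * f at (p ⊖ j)) ≈ (a ⊛ f) p
  ∑-at zero    zero    a f a≈0 = refl
  ∑-at zero    (suc p) a f a≈0 =
    +-congˡ (sym (⊛-zeroˡ-coeff f p (λ j j≤p → a≈0 (suc j) (s≤s z≤n) (s≤s j≤p))))
  ∑-at (suc N) zero    a f a≈0 =
    +-congˡ (∑-zero N (λ j → a (suc j) * f at (0 ⊖ suc j)) (λ j _ → zeroʳ (a (suc j))))
  ∑-at (suc N) (suc p) a f a≈0 = +-congˡ (trans
    (∑-cong N (λ j → a (suc j) * f at (suc p ⊖ suc j)) (λ j → a (suc j) * f at (p ⊖ j))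
      (λ j → *-congˡ (reflexive (≡.cong (f at_) (ℤₚ.[1+m]⊖[1+n]≡m⊖n p j)))))
    (∑-at N p (a /t) f (λ j N<j j≤p → a≈0 (suc j) (s≤s N<j) (s≤s j≤p))))

  -- The sequence whose exponential generating function is f.
  polynomials : Series → ℕ → Carrier
  polynomials f k = ι (k !) * f k

  polynomials-/! : ∀ f z → polynomials f /! z ≈ f at z
  polynomials-/! f -[1+ _ ] = refl
  polynomials-/! f (+ k)    = begin
    ι (k !) * f k * 1/ k !     ≈⟨ solve 3 (λ x y z → x :* y :* z := y :* (x :* z)) refl _ (f k) _ ⟩
    f k * (ι (k !) * 1/ k !)   ≈⟨ *-congˡ (ι*1/ι≈1 (k !) {{k ℕₚ.!≢0}}) ⟩
    f k * 1#                   ≈⟨ *-identityʳ _ ⟩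
    f k                        ∎

  -- The four sums of the relations as coefficients of tᵖ in products of series

  module _ (n m p : ℕ) where

    private
      α β γ : Series
      α = coeffα n m
      β = coeffβ n m
      γ = coeffγ n m

    left-sum : ∀ λ′ s F (a : Series) → (∀ j → a j ≈ λ′ * α j + s * β j) →
      ∑[ j ≤ m ⊔ n ] (a j * polynomials F /! (p ⊖ j))
        ≈ (((λ′ • α) ⊕ (s • β)) ⊛ F) p
    left-sum λ′ s F a a≈ = trans
      (∑-cong (m ⊔ n) (λ j → a j * polynomials F /! (p ⊖ j)) (λ j → a′ j * F at (p ⊖ j))
        (λ j → *-cong (a≈ j) (polynomials-/! F (p ⊖ j))))
      (∑-at (m ⊔ n) p a′ F λ j m⊔n<j _ → trans
        (+-cong
          (trans (*-congˡ (coeffα-vanishes m (ℕₚ.≤-<-trans (ℕₚ.m≤n⊔m m n) m⊔n<j))) (zeroʳ λ′))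
          (trans (*-congˡ (coeffβ-vanishes n (ℕₚ.≤-<-trans (ℕₚ.m≤m⊔n m n) m⊔n<j))) (zeroʳ s)))
        (+-identityˡ 0#))
      where
      a′ : Series
      a′ = (λ′ • α) ⊕ (s • β)

    -- The sum with β, which has polynomials of the lower order.  In the families ℬ and 𝒢 its index is shifted by
    -- one, which amounts to a factor t.
    middle-sum : ∀ H → ∑[ j ≤ m ] (β j * polynomials H /! (p ⊖ j)) ≈ (β ⊛ H) p
    middle-sum H = trans
      (∑-cong m (λ j → β j * polynomials H /! (p ⊖ j)) (λ j → β j * H at (p ⊖ j))
        (λ j → *-congˡ (polynomials-/! H (p ⊖ j))))
      (∑-at m p β H λ j m<j _ → coeffβ-vanishes n m<j)

    middle-sum-t· : ∀ H →
      ∑[ j ≤ m ] (β j * polynomials H /! (p ⊖ (j ℕ.+ 1))) ≈ (β ⊛ t· H) p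
    middle-sum-t· H = trans
      (∑-cong m (λ j → β j * polynomials H /! (p ⊖ (j ℕ.+ 1))) (λ j → β j * (t· H) at (p ⊖ j))
        (λ j → *-congˡ (shift j)))
      (∑-at m p β (t· H) λ j m<j _ → coeffβ-vanishes n m<j)
      where
      shift : ∀ j → polynomials H /! (p ⊖ (j ℕ.+ 1)) ≈ (t· H) at (p ⊖ j)
      shift j rewrite ℕₚ.+-comm j 1 =
        trans (polynomials-/! H (p ⊖ suc j)) (at-⊖-suc H p j)

    remainder-sum : ∀ F → p ≥ m ℕ.+ n ℕ.+ 1 →
      ∑[ j ≤ p ∸ (m ℕ.+ n ℕ.+ 1) ] (γ j * polynomials F /! (p ⊖ (m ℕ.+ n ℕ.+ j ℕ.+ 1)))
        ≈ (t^ suc (m ℕ.+ n) · (γ ⊛ F)) p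
    remainder-sum F p≥ = trans
      (∑-cong q (λ j → γ j * polynomials F /! (p ⊖ (m ℕ.+ n ℕ.+ j ℕ.+ 1))) (λ j → γ j * F at (q ⊖ j))
        (λ j → *-congˡ (trans (polynomials-/! F (p ⊖ (m ℕ.+ n ℕ.+ j ℕ.+ 1)))
                              (reflexive (≡.cong (F at_) (index j))))))
      (trans (∑-at q q γ F λ j q<j j≤q → ⊥-elim (ℕₚ.<⇒≱ q<j j≤q))
        (trans (sym (t^-coeff-≥ (suc (m ℕ.+ n)) (γ ⊛ F) q))
          (reflexive (≡.cong (t^ suc (m ℕ.+ n) · (γ ⊛ F)) N+q≡p))))
      where
      q : ℕ
      q = p ∸ (m ℕ.+ n ℕ.+ 1)

      N+q≡p : suc (m ℕ.+ n) ℕ.+ q ≡ p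
      N+q≡p = ≡.trans (≡.cong (ℕ._+ q) (ℕₚ.+-comm 1 (m ℕ.+ n))) (ℕₚ.m+[n∸m]≡n p≥)

      +-cancelˡ-⊖ : ∀ k a b → (k ℕ.+ a) ⊖ (k ℕ.+ b) ≡ a ⊖ b
      +-cancelˡ-⊖ zero    a b = ≡.refl
      +-cancelˡ-⊖ (suc k) a b =
        ≡.trans (ℤₚ.[1+m]⊖[1+n]≡m⊖n (k ℕ.+ a) (k ℕ.+ b)) (+-cancelˡ-⊖ k a b)

      index : ∀ j → p ⊖ (m ℕ.+ n ℕ.+ j ℕ.+ 1) ≡ q ⊖ j
      index j = ≡.trans
        (≡.cong₂ _⊖_ (≡.sym N+q≡p) (ℕₚ.+-comm (m ℕ.+ n ℕ.+ j) 1))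
        (+-cancelˡ-⊖ (suc (m ℕ.+ n)) q j)

    -- The common form of the relations.  The coefficients a_j on the left are
    -- λ α_j - β_j for s = -1 and λ α_j + β_j for s = 1.
    module _ (λ′ s : Carrier) {F K : Series} (eq : ((λ′ • exp-t 1#) ⊕ const s) ⊛ F ≋ K)
             (a : Series) (a≈ : ∀ j → a j ≈ λ′ * α j + s * β j) where

      relation-≤ : p ≤ m ℕ.+ n →
        ∑[ j ≤ m ⊔ n ] (a j * polynomials F /! (p ⊖ j)) ≈ (β ⊛ K) p
      relation-≤ p≤ = begin
        ∑[ j ≤ m ⊔ n ] (a j * polynomials F /! (p ⊖ j))
          ≈⟨ left-sum λ′ s F a a≈ ⟩
        P p
          ≈⟨ trans (+-congˡ (trans (*-congˡ (t^-coeff-< (γ ⊛ F) (s≤s p≤))) (zeroʳ λ′))) (+-identityʳ _) ⟨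
        P p + λ′ * (t^ suc (m ℕ.+ n) · (γ ⊛ F)) p
          ≈⟨ coeff (padé-relation n m λ′ s eq) p ⟩
        (β ⊛ K) p
          ∎
        where
        P : Series
        P = ((λ′ • α) ⊕ (s • β)) ⊛ F

      relation-≥ : p ≥ m ℕ.+ n ℕ.+ 1 →
        ∑[ j ≤ m ⊔ n ] (a j * polynomials F /! (p ⊖ j))
          ≈ (β ⊛ K) p - λ′ * ∑[ j ≤ p ∸ (m ℕ.+ n ℕ.+ 1) ]
              (γ j * polynomials F /! (p ⊖ (m ℕ.+ n ℕ.+ j ℕ.+ 1)))
      relation-≥ p≥ = begin
        ∑[ j ≤ m ⊔ n ] (a j * polynomials F /! (p ⊖ j))
          ≈⟨ left-sum λ′ s F a a≈ ⟩
        P p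
          ≈⟨ //-rightDividesʳ r (P p) ⟨
        P p + r - r
          ≈⟨ +-cong (coeff (padé-relation n m λ′ s eq) p)
                    (-‿cong (*-congˡ (sym (remainder-sum F p≥)))) ⟩
        (β ⊛ K) p - λ′ * ∑[ j ≤ p ∸ (m ℕ.+ n ℕ.+ 1) ]
              (γ j * polynomials F /! (p ⊖ (m ℕ.+ n ℕ.+ j ℕ.+ 1)))
          ∎
        where
        P : Series
        P = ((λ′ • α) ⊕ (s • β)) ⊛ F

        r : Carrier
        r = λ′ * (t^ suc (m ℕ.+ n) · (γ ⊛ F)) p

  -- Generating functions of consecutive orders

  f⊛inverse⊛g : ∀ f (f₀#0 : f 0 # 0#) g → f ⊛ (inverse f f₀#0 ⊛ g) ≋ g
  f⊛inverse⊛g f f₀#0 g =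
    f ⊛ (inverse f f₀#0 ⊛ g)   ≋⟨ ⊛-assoc f (inverse f f₀#0) g ⟨
    f ⊛ inverse f f₀#0 ⊛ g     ≋⟨ ⊛-congʳ g (inverse-inverseʳ f f₀#0) ⟩
    const 1# ⊛ g               ≋⟨ ⊛-identityˡ g ⟩
    g                          □

  f⊛[a•inverse]⊛g : ∀ f (f₀#0 : f 0 # 0#) a g → f ⊛ ((a • inverse f f₀#0) ⊛ g) ≋ a • g
  f⊛[a•inverse]⊛g f f₀#0 a g =
    f ⊛ ((a • inverse f f₀#0) ⊛ g)   ≋⟨ ⊛-congˡ f (•-⊛ a (inverse f f₀#0) g) ⟩
    f ⊛ (a • (inverse f f₀#0 ⊛ g))   ≋⟨ ⊛-• a f (inverse f f₀#0 ⊛ g) ⟩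
    a • (f ⊛ (inverse f f₀#0 ⊛ g))   ≋⟨ •-cong refl (f⊛inverse⊛g f f₀#0 g) ⟩
    a • g                            □

  t·-/t : ∀ f → f 0 ≈ 0# → f ≋ t· (f /t)
  t·-/t f f₀≈0 = pointwise λ where
    zero    → f₀≈0
    (suc n) → refl

  t·-⊛-t· : ∀ f g h {k} → f ⊛ (g ⊛ h) ≋ k → f ⊛ (t· g ⊛ h) ≋ t· k
  t·-⊛-t· f g h {k} p =
    f ⊛ (t· g ⊛ h)     ≋⟨ ⊛-congˡ f (t·-⊛ g h) ⟩
    f ⊛ t· (g ⊛ h)     ≋⟨ ⊛-t· f (g ⊛ h) ⟩
    t· (f ⊛ (g ⊛ h))   ≋⟨ t·-cong p ⟩
    t· k               □

  λeᵗ-1-constant : ∀ {λ′} → λ′ ≈ 1# → λeᵗ-1 λ′ 0 ≈ 0#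
  λeᵗ-1-constant {λ′} λ≈1 =
    trans (+-congʳ (trans (x*exp₀≈x λ′) λ≈1)) (-‿inverseʳ 1#)

  λeᵗ+1-constant : ∀ {λ′} → λ′ ≈ - 1# → λeᵗ+1 λ′ 0 ≈ 0#
  λeᵗ+1-constant {λ′} λ≈-1 =
    trans (+-congʳ (trans (x*exp₀≈x λ′) λ≈-1)) (-‿inverseˡ 1#)

  -- For λ = 1 the base is the inverse of (λ eᵗ - 1)/t, so the product with
  -- λ eᵗ - 1 = t · (λ eᵗ - 1)/t leaves a factor t.
  powerℬ-suc : ∀ {λ′} (α : Orderℬ λ′) → λeᵗ-1 λ′ ⊛ powerℬ (sucℬ α) ≋ t· powerℬ α
  powerℬ-suc {λ′} (complex λ≈1 L α) =
    λeᵗ-1 λ′ ⊛ pow b L (α + 1#)      ≋⟨ ⊛-cong (t·-/t (λeᵗ-1 λ′) (λeᵗ-1-constant λ≈1)) (pow-suc b L α) ⟩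
    t· (λeᵗ-1 λ′ /t) ⊛ (b ⊛ y)       ≋⟨ t·-⊛ (λeᵗ-1 λ′ /t) (b ⊛ y) ⟩
    t· ((λeᵗ-1 λ′ /t) ⊛ (b ⊛ y))     ≋⟨ t·-cong (f⊛inverse⊛g (λeᵗ-1 λ′ /t) ([λeᵗ-1]/t#0 λ′ λ≈1) y) ⟩
    t· y                             □
    where
    b y : Series
    b = baseℬ≡ λ′ λ≈1
    y = pow b L α
  powerℬ-suc {λ′} (natural λ#1 α) =
    t·-⊛-t· (λeᵗ-1 λ′) (inverse (λeᵗ-1 λ′) (λeᵗ-1#0 λ′ λ#1)) (baseℬ≠ λ′ λ#1 ^ₛ α)
      (f⊛inverse⊛g (λeᵗ-1 λ′) (λeᵗ-1#0 λ′ λ#1) (baseℬ≠ λ′ λ#1 ^ₛ α))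

  powerℰ-suc : ∀ {λ′} (α : Orderℰ λ′) → λeᵗ+1 λ′ ⊛ powerℰ (sucℰ α) ≋ ι 2 • powerℰ α
  powerℰ-suc {λ′} (complex λ#-1 L α) =
    λeᵗ+1 λ′ ⊛ pow b L (α + 1#)      ≋⟨ ⊛-congˡ (λeᵗ+1 λ′) (pow-suc b L α) ⟩
    λeᵗ+1 λ′ ⊛ (b ⊛ pow b L α)       ≋⟨ f⊛[a•inverse]⊛g (λeᵗ+1 λ′) (λeᵗ+1#0 λ′ λ#-1) (ι 2) (pow b L α) ⟩
    ι 2 • pow b L α                  □
    where
    b : Series
    b = baseℰ λ′ λ#-1

  power𝒢-suc : ∀ {λ′} (α : Order𝒢 λ′) →
    λeᵗ+1 λ′ ⊛ power𝒢 (suc𝒢 α) ≋ t· (ι 2 • power𝒢 α)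
  power𝒢-suc {λ′} (complex λ≈-1 L α) =
    λeᵗ+1 λ′ ⊛ pow b L (α + 1#)      ≋⟨ ⊛-cong (t·-/t (λeᵗ+1 λ′) (λeᵗ+1-constant λ≈-1)) (pow-suc b L α) ⟩
    t· (λeᵗ+1 λ′ /t) ⊛ (b ⊛ y)       ≋⟨ t·-⊛ (λeᵗ+1 λ′ /t) (b ⊛ y) ⟩
    t· ((λeᵗ+1 λ′ /t) ⊛ (b ⊛ y))     ≋⟨ t·-cong (f⊛[a•inverse]⊛g (λeᵗ+1 λ′ /t) ([λeᵗ+1]/t#0 λ′ λ≈-1) (ι 2) y) ⟩
    t· (ι 2 • y)                     □
    where
    b y : Series
    b = base𝒢≡ λ′ λ≈-1
    y = pow b L α
  power𝒢-suc {λ′} (natural λ#-1 α) =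
    t·-⊛-t· (λeᵗ+1 λ′) (ι 2 • inverse (λeᵗ+1 λ′) (λeᵗ+1#0 λ′ λ#-1)) (base𝒢≠ λ′ λ#-1 ^ₛ α)
      (f⊛[a•inverse]⊛g (λeᵗ+1 λ′) (λeᵗ+1#0 λ′ λ#-1) (ι 2) (base𝒢≠ λ′ λ#-1 ^ₛ α))

  ℬ-equation : ∀ {λ′} (α : Orderℬ λ′) x →
    λeᵗ-1 λ′ ⊛ (powerℬ (sucℬ α) ⊛ exp-t x) ≋ t· (powerℬ α ⊛ exp-t x)
  ℬ-equation {λ′} α x =
    λeᵗ-1 λ′ ⊛ (powerℬ (sucℬ α) ⊛ exp-t x)   ≋⟨ ⊛-assoc (λeᵗ-1 λ′) (powerℬ (sucℬ α)) (exp-t x) ⟨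
    λeᵗ-1 λ′ ⊛ powerℬ (sucℬ α) ⊛ exp-t x     ≋⟨ ⊛-congʳ (exp-t x) (powerℬ-suc α) ⟩
    t· powerℬ α ⊛ exp-t x                    ≋⟨ t·-⊛ (powerℬ α) (exp-t x) ⟩
    t· (powerℬ α ⊛ exp-t x)                  □

  ℰ-equation : ∀ {λ′} (α : Orderℰ λ′) x →
    λeᵗ+1 λ′ ⊛ (powerℰ (sucℰ α) ⊛ exp-t x) ≋ ι 2 • (powerℰ α ⊛ exp-t x)
  ℰ-equation {λ′} α x =
    λeᵗ+1 λ′ ⊛ (powerℰ (sucℰ α) ⊛ exp-t x)   ≋⟨ ⊛-assoc (λeᵗ+1 λ′) (powerℰ (sucℰ α)) (exp-t x) ⟨
    λeᵗ+1 λ′ ⊛ powerℰ (sucℰ α) ⊛ exp-t x     ≋⟨ ⊛-congʳ (exp-t x) (powerℰ-suc α) ⟩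
    (ι 2 • powerℰ α) ⊛ exp-t x               ≋⟨ •-⊛ (ι 2) (powerℰ α) (exp-t x) ⟩
    ι 2 • (powerℰ α ⊛ exp-t x)               □

  𝒢-equation : ∀ {λ′} (α : Order𝒢 λ′) x →
    λeᵗ+1 λ′ ⊛ (power𝒢 (suc𝒢 α) ⊛ exp-t x) ≋ ι 2 • t· (power𝒢 α ⊛ exp-t x)
  𝒢-equation {λ′} α x =
    λeᵗ+1 λ′ ⊛ (power𝒢 (suc𝒢 α) ⊛ exp-t x)   ≋⟨ ⊛-assoc (λeᵗ+1 λ′) (power𝒢 (suc𝒢 α)) (exp-t x) ⟨
    λeᵗ+1 λ′ ⊛ power𝒢 (suc𝒢 α) ⊛ exp-t x     ≋⟨ ⊛-congʳ (exp-t x) (power𝒢-suc α) ⟩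
    t· (ι 2 • power𝒢 α) ⊛ exp-t x            ≋⟨ ⊛-congʳ (exp-t x) t·-• ⟩
    (ι 2 • t· power𝒢 α) ⊛ exp-t x            ≋⟨ •-⊛ (ι 2) (t· power𝒢 α) (exp-t x) ⟩
    ι 2 • (t· power𝒢 α ⊛ exp-t x)            ≋⟨ •-cong refl (t·-⊛ (power𝒢 α) (exp-t x)) ⟩
    ι 2 • t· (power𝒢 α ⊛ exp-t x)            □
    where
    t·-• : t· (ι 2 • power𝒢 α) ≋ ι 2 • t· power𝒢 α
    t·-• = pointwise λ where
      zero    → sym (zeroʳ (ι 2))
      (suc n) → refl

  -- The relations for the three families

  module _ (n m p : ℕ) where

    private
      β : Series
      β = coeffβ n m

      minus : ∀ x y → x - y ≈ x + - 1# * y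
      minus x y = +-congˡ (sym (-1*x≈-x y))

      plus : ∀ x y → x + y ≈ x + 1# * y
      plus x y = +-congˡ (sym (*-identityˡ y))

    ℬ-right : ∀ {λ′} (α : Orderℬ λ′) x →
      (β ⊛ t· (powerℬ α ⊛ exp-t x)) p ≈ ∑[ j ≤ m ] (β j * ℬ α x /! (p ⊖ (j ℕ.+ 1)))
    ℬ-right α x = sym (middle-sum-t· n m p (powerℬ α ⊛ exp-t x))

    ℰ-right : ∀ {λ′} (α : Orderℰ λ′) x →
      (β ⊛ (ι 2 • (powerℰ α ⊛ exp-t x))) p ≈ ι 2 * ∑[ j ≤ m ] (β j * ℰ α x /! (p ⊖ j))
    ℰ-right α x = trans (coeff (⊛-• (ι 2) β (powerℰ α ⊛ exp-t x)) p)
      (*-congˡ (sym (middle-sum n m p (powerℰ α ⊛ exp-t x))))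

    𝒢-right : ∀ {λ′} (α : Order𝒢 λ′) x →
      (β ⊛ (ι 2 • t· (power𝒢 α ⊛ exp-t x))) p
        ≈ ι 2 * ∑[ j ≤ m ] (β j * 𝒢 α x /! (p ⊖ (j ℕ.+ 1)))
    𝒢-right α x = trans (coeff (⊛-• (ι 2) β (t· (power𝒢 α ⊛ exp-t x))) p)
      (*-congˡ (sym (middle-sum-t· n m p (power𝒢 α ⊛ exp-t x))))

    relations-≤ : p ≤ m ℕ.+ n →
      ((λ′ : Carrier) (α : Orderℬ λ′) (x : Carrier) →
        ∑[ j ≤ m ⊔ n ] ((λ′ * coeffα n m j - β j) * ℬ (sucℬ α) x /! (p ⊖ j))
          ≈ ∑[ j ≤ m ] (β j * ℬ α x /! (p ⊖ (j ℕ.+ 1))))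
      × ((λ′ : Carrier) (α : Orderℰ λ′) (x : Carrier) →
        ∑[ j ≤ m ⊔ n ] ((λ′ * coeffα n m j + β j) * ℰ (sucℰ α) x /! (p ⊖ j))
          ≈ ι 2 * ∑[ j ≤ m ] (β j * ℰ α x /! (p ⊖ j)))
      × ((λ′ : Carrier) (α : Order𝒢 λ′) (x : Carrier) →
        ∑[ j ≤ m ⊔ n ] ((λ′ * coeffα n m j + β j) * 𝒢 (suc𝒢 α) x /! (p ⊖ j))
          ≈ ι 2 * ∑[ j ≤ m ] (β j * 𝒢 α x /! (p ⊖ (j ℕ.+ 1))))
    relations-≤ p≤
      = (λ λ′ α x → trans
          (relation-≤ n m p λ′ (- 1#) (ℬ-equation α x) (λ j → λ′ * coeffα n m j - β j)
            (λ j → minus _ (β j)) p≤)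
          (ℬ-right α x))
      , (λ λ′ α x → trans
          (relation-≤ n m p λ′ 1# (ℰ-equation α x) (λ j → λ′ * coeffα n m j + β j)
            (λ j → plus _ (β j)) p≤)
          (ℰ-right α x))
      , (λ λ′ α x → trans
          (relation-≤ n m p λ′ 1# (𝒢-equation α x) (λ j → λ′ * coeffα n m j + β j)
            (λ j → plus _ (β j)) p≤)
          (𝒢-right α x))

    relations-≥ : p ≥ m ℕ.+ n ℕ.+ 1 →
      ((λ′ : Carrier) (α : Orderℬ λ′) (x : Carrier) →
        ∑[ j ≤ m ⊔ n ] ((λ′ * coeffα n m j - β j) * ℬ (sucℬ α) x /! (p ⊖ j))
          ≈ ∑[ j ≤ m ] (β j * ℬ α x /! (p ⊖ (j ℕ.+ 1)))
            - λ′ * ∑[ j ≤ p ∸ (m ℕ.+ n ℕ.+ 1) ]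
                (coeffγ n m j * ℬ (sucℬ α) x /! (p ⊖ (m ℕ.+ n ℕ.+ j ℕ.+ 1))))
      × ((λ′ : Carrier) (α : Orderℰ λ′) (x : Carrier) →
        ∑[ j ≤ m ⊔ n ] ((λ′ * coeffα n m j + β j) * ℰ (sucℰ α) x /! (p ⊖ j))
          ≈ ι 2 * ∑[ j ≤ m ] (β j * ℰ α x /! (p ⊖ j))
            - λ′ * ∑[ j ≤ p ∸ (m ℕ.+ n ℕ.+ 1) ]
                (coeffγ n m j * ℰ (sucℰ α) x /! (p ⊖ (m ℕ.+ n ℕ.+ j ℕ.+ 1))))
      × ((λ′ : Carrier) (α : Order𝒢 λ′) (x : Carrier) →
        ∑[ j ≤ m ⊔ n ] ((λ′ * coeffα n m j + β j) * 𝒢 (suc𝒢 α) x /! (p ⊖ j))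
          ≈ ι 2 * ∑[ j ≤ m ] (β j * 𝒢 α x /! (p ⊖ (j ℕ.+ 1)))
            - λ′ * ∑[ j ≤ p ∸ (m ℕ.+ n ℕ.+ 1) ]
                (coeffγ n m j * 𝒢 (suc𝒢 α) x /! (p ⊖ (m ℕ.+ n ℕ.+ j ℕ.+ 1))))
    relations-≥ p≥
      = (λ λ′ α x → trans
          (relation-≥ n m p λ′ (- 1#) (ℬ-equation α x) (λ j → λ′ * coeffα n m j - β j)
            (λ j → minus _ (β j)) p≥)
          (+-congʳ (ℬ-right α x)))
      , (λ λ′ α x → trans
          (relation-≥ n m p λ′ 1# (ℰ-equation α x) (λ j → λ′ * coeffα n m j + β j)
            (λ j → plus _ (β j)) p≥)
          (+-congʳ (ℰ-right α x)))
      , (λ λ′ α x → trans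
          (relation-≥ n m p λ′ 1# (𝒢-equation α x) (λ j → λ′ * coeffα n m j + β j)
            (λ j → plus _ (β j)) p≥)
          (+-congʳ (𝒢-right α x)))

theorem2 : ∀ {c ℓ₁ ℓ₂} (𝕂 : ExponentialField c ℓ₁ ℓ₂) →
  let open Apostol 𝕂 in
  (n m p : ℕ) →
  let αₙₘ = coeffα n m
      βₙₘ = coeffβ n m
      γₙₘ = coeffγ n m
  in
  (p ≤ m ℕ.+ n →
    ((λ′ : Carrier) (α : Orderℬ λ′) (x : Carrier) →
      ∑[ j ≤ m ⊔ n ] ((λ′ * αₙₘ j - βₙₘ j) * ℬ (sucℬ α) x /! (p ⊖ j))
        ≈ ∑[ j ≤ m ] (βₙₘ j * ℬ α x /! (p ⊖ (j ℕ.+ 1))))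
    × ((λ′ : Carrier) (α : Orderℰ λ′) (x : Carrier) →
      ∑[ j ≤ m ⊔ n ] ((λ′ * αₙₘ j + βₙₘ j) * ℰ (sucℰ α) x /! (p ⊖ j))
        ≈ ι 2 * ∑[ j ≤ m ] (βₙₘ j * ℰ α x /! (p ⊖ j)))
    × ((λ′ : Carrier) (α : Order𝒢 λ′) (x : Carrier) →
      ∑[ j ≤ m ⊔ n ] ((λ′ * αₙₘ j + βₙₘ j) * 𝒢 (suc𝒢 α) x /! (p ⊖ j))
        ≈ ι 2 * ∑[ j ≤ m ] (βₙₘ j * 𝒢 α x /! (p ⊖ (j ℕ.+ 1)))))
  ×
  (p ≥ m ℕ.+ n ℕ.+ 1 →
    ((λ′ : Carrier) (α : Orderℬ λ′) (x : Carrier) →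
      ∑[ j ≤ m ⊔ n ] ((λ′ * αₙₘ j - βₙₘ j) * ℬ (sucℬ α) x /! (p ⊖ j))
        ≈ ∑[ j ≤ m ] (βₙₘ j * ℬ α x /! (p ⊖ (j ℕ.+ 1)))
          - λ′ * ∑[ j ≤ p ∸ (m ℕ.+ n ℕ.+ 1) ]
              (γₙₘ j * ℬ (sucℬ α) x /! (p ⊖ (m ℕ.+ n ℕ.+ j ℕ.+ 1))))
    × ((λ′ : Carrier) (α : Orderℰ λ′) (x : Carrier) →
      ∑[ j ≤ m ⊔ n ] ((λ′ * αₙₘ j + βₙₘ j) * ℰ (sucℰ α) x /! (p ⊖ j))
        ≈ ι 2 * ∑[ j ≤ m ] (βₙₘ j * ℰ α x /! (p ⊖ j))
          - λ′ * ∑[ j ≤ p ∸ (m ℕ.+ n ℕ.+ 1) ]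
              (γₙₘ j * ℰ (sucℰ α) x /! (p ⊖ (m ℕ.+ n ℕ.+ j ℕ.+ 1))))
    × ((λ′ : Carrier) (α : Order𝒢 λ′) (x : Carrier) →
      ∑[ j ≤ m ⊔ n ] ((λ′ * αₙₘ j + βₙₘ j) * 𝒢 (suc𝒢 α) x /! (p ⊖ j))
        ≈ ι 2 * ∑[ j ≤ m ] (βₙₘ j * 𝒢 α x /! (p ⊖ (j ℕ.+ 1)))
          - λ′ * ∑[ j ≤ p ∸ (m ℕ.+ n ℕ.+ 1) ]
              (γₙₘ j * 𝒢 (suc𝒢 α) x /! (p ⊖ (m ℕ.+ n ℕ.+ j ℕ.+ 1)))))
theorem2 𝕂 n m p = relations-≤ n m p , relations-≥ n m p
  where open FormalSeries 𝕂
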